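{- There exists a (randomized) streaming algorithm that, given $n$ coins arriving one by one in a stream in arbitrary order, with gap parameter $\Delta>0$ and confidence parameter $\delta\in(0,1)$, finds the most biased coin with probability at least $1-\delta$ using $O\!\left(\frac{n}{\Delta^2}\cdot\log(1/\delta)\right)$ coin tosses and a memory of $\lceil\log^{*}(n)\rceil+1$ coins.
   Context: Streaming coin tossing. There are $n$ coins with unknown biases $p_1,\dots,p_n\in[0,1]$; each toss of the $i$-th coin is an independent Bernoulli$(p_i)$ random variable. The gap parameter $\Delta$ is the difference between the largest bias and the second largest bias; it is assumed that $\Delta>0$ (so the most biased coin is unique) and that $n,\Delta,\delta$ are known to the algorithm. The coins arrive one by one in a stream. At any time the algorithm may toss only the currently arriving coin or a coin explicitly stored in its memory; a coin that is not stored, or that is removed from memory, can no longer be tossed or recovered. The memory of the algorithm is the maximum number of coins it stores at any point (the currently arriving coin is not counted unless stored; auxiliary information such as counters is not counted). "Finds the most biased coin" means that at the end of the stream the algorithm outputs the coin with the largest bias. $\log^{*}(n)$ is the iterated logarithm (the number of times $\log_2$ must be applied to $n$ before the result is at most $1$). $O(\cdot)$ hides an absolute constant. -}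

module Defs where

open import Algebra.Apartness.Bundles using (HeytingField)
open import Algebra.Bundles using (CommutativeRing)
import Algebra.Definitions.RawMonoid as RawMonoidDefinitions
import Algebra.Properties.Ring as RingProperties
open import Data.Bool.Base using (Bool; true; false; if_then_else_)
open import Data.Empty using (⊥-elim)
open import Data.Fin.Base using (Fin)
open import Data.Fin.Permutation using (Permutation′; _⟨$⟩ʳ_)
open import Data.Fin.Properties using (_≟_)
open import Data.Nat.Base as ℕ using (ℕ; zero; suc; _⊔_)
open import Data.Product.Base using (∃-syntax; _×_; _,_; proj₁; proj₂)
open import Data.Sum.Base using (_⊎_; inj₁; inj₂)
open import Data.Vec.Base using (Vec; []; _∷_; lookup; removeAt; tabulate)
import Data.Vec.Functional as Vector
open import Function.Bundles using (_⇔_; Equivalence)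
open import Level using () renaming (suc to lsuc; _⊔_ to _⊔ℓ_)
open import Relation.Binary.Core using (Rel)
open import Relation.Binary.Definitions using (Cotransitive)
open import Relation.Binary.Structures using (IsStrictPartialOrder)
open import Relation.Binary.PropositionalEquality.Core using (_≢_)
open import Relation.Nullary.Decidable.Core using (⌊_⌋)
open import Relation.Nullary.Negation.Core using (¬_)

-- The real numbers, axiomatised up to isomorphism as the Cauchy-complete
-- Archimedean ordered field.  The axioms are the constructive ones (the order
-- is cotransitive rather than trichotomous), so both the classical reals and
-- the constructive Cauchy reals are models.

record Reals c ℓ₁ ℓ₂ : Set (lsuc (c ⊔ℓ ℓ₁ ⊔ℓ ℓ₂)) where
  infix 4 _<_ _≤_
  field
    heytingField : HeytingField c ℓ₁ ℓ₂

  open HeytingField heytingField public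

  commutativeRing : CommutativeRing c ℓ₁
  commutativeRing = record { isCommutativeRing = isCommutativeRing }

  private
    module + = RawMonoidDefinitions
      (CommutativeRing.+-rawMonoid commutativeRing)

  fromℕ : ℕ → Carrier
  fromℕ n = n +.× 1#

  sum : ∀ {n} → (Fin n → Carrier) → Carrier
  sum = +.sum

  field
    _<_                  : Rel Carrier ℓ₂
    isStrictPartialOrder : IsStrictPartialOrder _≈_ _<_
    <-cotrans            : Cotransitive _<_
    #⇔<⊎>                : ∀ {x y} → x # y ⇔ (x < y ⊎ y < x)
    +-monoˡ-<            : ∀ {x y} z → x < y → x + z < y + z
    *-pos                : ∀ {x y} → 0# < x → 0# < y → 0# < x * y
    archimedean          : ∀ x → ∃[ n ] x < fromℕ n

  _≤_ : Rel Carrier ℓ₂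
  x ≤ y = ¬ (y < x)

  Cauchy : (ℕ → Carrier) → Set (c ⊔ℓ ℓ₂)
  Cauchy f = ∀ ε → 0# < ε →
    ∃[ N ] (∀ m n → N ℕ.≤ m → N ℕ.≤ n → f m < f n + ε)

  _ConvergesTo_ : (ℕ → Carrier) → Carrier → Set (c ⊔ℓ ℓ₂)
  f ConvergesTo x = ∀ ε → 0# < ε →
    ∃[ N ] (∀ n → N ℕ.≤ n → f n < x + ε × x < f n + ε)

  field
    complete : ∀ f → Cauchy f → ∃[ x ] f ConvergesTo x

  private
    module SPO = IsStrictPartialOrder isStrictPartialOrder
    module R = CommutativeRing commutativeRing
    open RingProperties R.ring
      using (-‿involutive; -‿distribˡ-*; -‿distribʳ-*; -0#≈0#)

    <-respʳ-≈ : ∀ {x y z} → y ≈ z → x < y → x < z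
    <-respʳ-≈ = proj₁ SPO.<-resp-≈

    <-respˡ-≈ : ∀ {x y z} → y ≈ z → y < x → z < x
    <-respˡ-≈ = proj₂ SPO.<-resp-≈

    x-0≈x : ∀ x → x - 0# ≈ x
    x-0≈x x = R.trans (R.+-congˡ -0#≈0#) (R.+-identityʳ x)

    invertible⇒#0 : ∀ {x y} → y * x ≈ 1# → y # 0#
    invertible⇒#0 {x} {y} yx≈1 = invertible⇒#
      ( x
      , R.trans (R.*-congˡ (x-0≈x y)) (R.trans (R.*-comm x y) yx≈1)
      , R.trans (R.*-congʳ (x-0≈x y)) yx≈1)

    neg⇒pos : ∀ {x} → x < 0# → 0# < - x
    neg⇒pos {x} x<0 =
      <-respʳ-≈ (R.+-identityˡ (- x))
        (<-respˡ-≈ (R.-‿inverseʳ x) (+-monoˡ-< (- x) x<0))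

  0<1 : 0# < 1#
  0<1 with Equivalence.to #⇔<⊎> (invertible⇒#0 (R.*-identityʳ 1#))
  ... | inj₂ 0<1 = 0<1
  ... | inj₁ 1<0 = <-respʳ-≈ -1*-1≈1 (*-pos (neg⇒pos 1<0) (neg⇒pos 1<0))
    where
    -1*-1≈1 : - 1# * - 1# ≈ 1#
    -1*-1≈1 =
      R.trans (R.sym (-‿distribˡ-* 1# (- 1#)))
        (R.trans (R.-‿cong (R.*-identityˡ (- 1#))) (-‿involutive 1#))

  fromℕ-pos : ∀ n → 0# < fromℕ (suc n)
  fromℕ-pos zero    = <-respʳ-≈ (R.sym (R.+-identityʳ 1#)) 0<1
  fromℕ-pos (suc n) = SPO.trans (fromℕ-pos n)
    (<-respˡ-≈ (R.+-identityˡ (fromℕ (suc n)))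
      (+-monoˡ-< (fromℕ (suc n)) 0<1))

  recip : ∀ x → 0# < x → Carrier
  recip x x>0 = proj₁ (#⇒invertible {x} {0#} (Equivalence.from #⇔<⊎> (inj₂ x>0)))

  recip-inverseˡ : ∀ x (x>0 : 0# < x) → recip x x>0 * x ≈ 1#
  recip-inverseˡ x x>0 = R.trans (R.*-congˡ (R.sym (x-0≈x x)))
    (proj₁ (proj₂ (#⇒invertible (Equivalence.from #⇔<⊎> (inj₂ x>0)))))

  recip-pos : ∀ x (x>0 : 0# < x) → 0# < recip x x>0
  recip-pos x x>0
    with Equivalence.to #⇔<⊎> (invertible⇒#0 (recip-inverseˡ x x>0))
  ... | inj₂ 0<y = 0<y
  ... | inj₁ y<0 = ⊥-elim (SPO.irrefl R.refl (SPO.trans 0<1 1<0))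
    where
    y = recip x x>0
    0<-1 : 0# < - 1#
    0<-1 = <-respʳ-≈
      (R.trans (R.sym (-‿distribˡ-* y x)) (R.-‿cong (recip-inverseˡ x x>0)))
      (*-pos (neg⇒pos y<0) x>0)
    1<0 : 1# < 0#
    1<0 = <-respʳ-≈ (R.-‿inverseˡ 1#)
      (<-respˡ-≈ (R.+-identityˡ 1#) (+-monoˡ-< 1# 0<-1))

-- The binary logarithm is the only monotone homomorphism from the positive
-- reals under multiplication to the reals under addition that sends 2 to 1.

record BinaryLogarithm {c ℓ₁ ℓ₂} (ℝ : Reals c ℓ₁ ℓ₂) : Set (c ⊔ℓ ℓ₁ ⊔ℓ ℓ₂) where
  open Reals ℝ
  field
    log₂        : ∀ x → 0# < x → Carrier
    log₂-mono-≤ : ∀ {x y} (x>0 : 0# < x) (y>0 : 0# < y) →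
                  x ≤ y → log₂ x x>0 ≤ log₂ y y>0
    log₂-*      : ∀ {x y} (x>0 : 0# < x) (y>0 : 0# < y) →
                  log₂ (x * y) (*-pos x>0 y>0) ≈ log₂ x x>0 + log₂ y y>0
    log₂-2      : log₂ (fromℕ 2) (fromℕ-pos 1) ≈ 1#

  -- IsLog* x k: log* x = k, for real x.  The iteration stops at the first
  -- value that is at most 1, so every logarithm taken has argument above 1.

  data IsLog* : Carrier → ℕ → Set (c ⊔ℓ ℓ₂) where
    stop : ∀ {x} → x ≤ 1# → IsLog* x 0
    step : ∀ {x k} (x>0 : 0# < x) → 1# < x →
           IsLog* (log₂ x x>0) k → IsLog* x (suc k)

-- A Strategy u k continues a run in which u coins of the stream have not yet
-- passed, the first of them being the one currently presented, and k coins are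
-- stored.  Branches may depend on all earlier outcomes, which makes auxiliary
-- memory free, but coins can be accessed only through the current
-- position of the stream and the stored positions.

data Strategy : (u k : ℕ) → Set where
  tossCurrent : ∀ {u k} → (Bool → Strategy (suc u) k) → Strategy (suc u) k
  tossStored  : ∀ {u k} → Fin k → (Bool → Strategy u k) → Strategy u k
  store       : ∀ {u k} → Strategy (suc u) (suc k) → Strategy (suc u) k
  discard     : ∀ {u k} → Fin (suc k) → Strategy u k → Strategy u (suc k)
  -- internal randomness: a uniform element of Fin (suc b)
  randomise   : ∀ {u k} b → (Fin (suc b) → Strategy u k) → Strategy u k
  next        : ∀ {u k} → Strategy u k → Strategy (suc u) k
  output      : ∀ {k} → Fin k → Strategy 0 k

Algorithm : ℕ → Set
Algorithm n = Strategy n 0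

maximum : ∀ {n} → (Fin n → ℕ) → ℕ
maximum = Vector.foldr _⊔_ 0

-- Worst case over all outcomes of the coins and of the internal randomness.

tosses : ∀ {u k} → Strategy u k → ℕ
tosses (tossCurrent s)  = suc (tosses (s true) ⊔ tosses (s false))
tosses (tossStored _ s) = suc (tosses (s true) ⊔ tosses (s false))
tosses (store s)        = tosses s
tosses (discard _ s)    = tosses s
tosses (randomise _ s)  = maximum (λ i → tosses (s i))
tosses (next s)         = tosses s
tosses (output _)       = 0

memory : ∀ {u k} → Strategy u k → ℕ
memory {k = k} (tossCurrent s)  = k ⊔ (memory (s true) ⊔ memory (s false))
memory {k = k} (tossStored _ s) = k ⊔ (memory (s true) ⊔ memory (s false))
memory {k = k} (store s)        = k ⊔ memory s
memory {k = k} (discard _ s)    = k ⊔ memory s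
memory {k = k} (randomise _ s)  = k ⊔ maximum (λ i → memory (s i))
memory {k = k} (next s)         = k ⊔ memory s
memory {k = k} (output _)       = k

module Coins {c ℓ₁ ℓ₂} (ℝ : Reals c ℓ₁ ℓ₂) where
  open Reals ℝ

  IsBias : Carrier → Set ℓ₂
  IsBias x = 0# ≤ x × x ≤ 1#

  MostBiased : ∀ {n} → (Fin n → Carrier) → Fin n → Set ℓ₂
  MostBiased p i = ∀ j → p j ≤ p i

  IsGap : ∀ {n} → (Fin n → Carrier) → Carrier → Set (ℓ₁ ⊔ℓ ℓ₂)
  IsGap p Δ = ∃[ i ] ∃[ j ]
    i ≢ j × MostBiased p i × (∀ k → k ≢ i → p k ≤ p j) × Δ ≈ p i - p j

  module _ {n} (p : Fin n → Carrier) (target : Fin n) where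

    -- The probability of outputting the target, by the law of total
    -- probability: each toss is independent of everything before it.

    outputProbability : ∀ {u k} → Strategy u k → Vec (Fin n) u → Vec (Fin n) k → Carrier
    outputProbability (tossCurrent s) (x ∷ xs) m =
      p x * outputProbability (s true) (x ∷ xs) m
        + (1# - p x) * outputProbability (s false) (x ∷ xs) m
    outputProbability (tossStored i s) xs m =
      p (lookup m i) * outputProbability (s true) xs m
        + (1# - p (lookup m i)) * outputProbability (s false) xs m
    outputProbability (store s) (x ∷ xs) m = outputProbability s (x ∷ xs) (x ∷ m)
    outputProbability (discard i s) xs m = outputProbability s xs (removeAt m i)
    outputProbability (randomise b s) xs m =
      recip (fromℕ (suc b)) (fromℕ-pos b)
        * sum (λ i → outputProbability (s i) xs m)
    outputProbability (next s) (x ∷ xs) m = outputProbability s xs m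
    outputProbability (output i) [] m =
      if ⌊ lookup m i ≟ target ⌋ then 1# else 0#

  -- The coin arriving at time t is σ ⟨$⟩ʳ t.

  Pr[_outputs_∣biases_,order_] : ∀ {n} →
    Algorithm n → Fin n → (Fin n → Carrier) → Permutation′ n → Carrier
  Pr[ A outputs i ∣biases p ,order σ ] =
    outputProbability p i A (tabulate (σ ⟨$⟩ʳ_)) []

module Submission where

-- Run a tournament given by a binary tree whose leaves are the coins in order of
-- arrival.  While the right subtree of a node is run only the champion of the
-- left one is stored, so the memory needed obeys the register recursion
-- max(l, r + 1).  A comparison labelled w uses O((D + w)/Δ²) tosses and errs with
-- probability at most 2⁻⁽ᴰ⁺ʷ⁾.  A tree of level ℓ + 1 is a left comb of trees of
-- level ℓ with tower ℓ · 2^ℓ leaves each, where tower ℓ is the inverse of log*.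
-- Labels of order tower ℓ suffice for the combs, so that the labels of the whole
-- tree sum to O(n), the errors along a path to at most 2⁻ᴰ, and a level-ℓ tree
-- needs ℓ + 1 registers.
--
-- When δ is close to 1 there are not enough tosses to look at all the coins.
-- Then only a random window of the stream is searched.

open import Defs
open import Algebra.Bundles using (CommutativeRing; RawRing)
import Algebra.Properties.AbelianGroup as AbelianGroupProperties
import Algebra.Properties.Ring as RingProperties
import Algebra.Properties.Semiring.Exp as SemiringExp
import Algebra.Properties.Semiring.Mult as SemiringMult
import Algebra.Properties.Semiring.Mult.TCOptimised as SemiringMultTC
import Algebra.Solver.Ring as RingSolver
open import Algebra.Solver.Ring.AlmostCommutativeRing using (_-Raw-AlmostCommutative⟶_; fromCommutativeRing)
open import Data.Bool.Base using (Bool; true; false)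
open import Data.Empty using (⊥; ⊥-elim)
open import Data.Fin.Base using (Fin; zero; suc; toℕ; fromℕ<)
open import Data.Fin.Permutation using (Permutation′; _⟨$⟩ʳ_; _⟨$⟩ˡ_; inverseʳ)
open import Data.Fin.Properties using (_≟_; toℕ-fromℕ<)
open import Data.Integer.Base as ℤ using (ℤ; +_; -[1+_])
import Data.Integer.Properties as ℤ
open import Data.Maybe.Base using (Maybe; just; nothing)
open import Data.Nat.Base as ℕ using (ℕ; zero; suc; NonZero; _⊓_; _⊔_; _≤′_; ≤′-reflexive; ≤′-step)
open import Data.Nat.DivMod using (_/_; _%_; m≡m%n+[m/n]*n; m%n<n; m/n*n≤m; m/n≤m; m<n*o⇒m/o<n)
import Data.Nat.Properties as ℕ
open import Data.Nat.Tactic.RingSolver using (solve-∀)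
open import Data.Product.Base using (∃-syntax; Σ-syntax; _×_; _,_; proj₁; proj₂)
open import Data.Sum.Base using (_⊎_; inj₁; inj₂)
open import Data.Vec.Base using (Vec; []; _∷_; lookup; removeAt; tabulate)
open import Data.Vec.Properties using (lookup∘tabulate)
open import Function.Bundles using (Equivalence)
open import Relation.Binary.PropositionalEquality.Core as ≡ using (_≡_; _≢_)
import Relation.Binary.Reasoning.Base.Triple as TripleReasoning
open import Relation.Binary.Structures using (IsPreorder; IsStrictPartialOrder)
open import Relation.Nullary.Decidable.Core using (yes; no)
open import Relation.Nullary.Negation.Core using (¬_)

-- The exponential growth per level is exactly what a union bound affords. A tree of level ℓ + 1 has
-- at most 2^(`tower ℓ` + ℓ + 1) coins, so the best coin meets at most that many comb joins there.
-- Making their errors sum to 2^-(D + ℓ + 1) takes `tower ℓ` + 2(ℓ + 1) extra bits per join, fewer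
-- than 4 `tower ℓ`. A comb has one join per `tower ℓ` · 2^ℓ coins, so this costs at most 4 · 2^-ℓ
-- per coin: the factor 2^ℓ in the block size makes the costs over all levels sum to at most 8.
--
-- Only joins met by the best coin have to be decided correctly; every other champion may be
-- arbitrary. Probabilities are therefore handled as lower bounds `V` on the success of a
-- continuation, and no joint distribution of champions is needed.
--
-- With B windows the best coin lies in the chosen one with probability at least 1/B, which suffices
-- if B is about 1/(1 - δ). A window of one coin needs no toss at all, so the bound survives
-- arbitrarily small budgets.
--
-- The order on the reals is undecidable, so every choice depending on Δ or δ is made between
-- overlapping cases by cotransitivity.

-- Ring solver with integer coefficients

module IntegerSolver {c ℓ} (R : CommutativeRing c ℓ) where
  open CommutativeRing R
  open RingProperties ring
  open AbelianGroupProperties +-abelianGroup using (⁻¹-∙-comm)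
  open SemiringMultTC semiring using (×-homo-+; ×1-homo-*; 1+×) renaming (_×_ to _·_)
  open import Relation.Binary.Reasoning.Setoid setoid

  ⟦_⟧ : ℤ → Carrier
  ⟦ + n ⟧      = n · 1#
  ⟦ -[1+ n ] ⟧ = - (suc n · 1#)

  private
    cancel : ∀ a b d → (d + a) - (d + b) ≈ a - b
    cancel a b d = begin
      (d + a) - (d + b)       ≈⟨ +-cong (+-comm d a) (sym (⁻¹-∙-comm d b)) ⟩
      (a + d) + (- d + - b)   ≈⟨ +-assoc a d _ ⟩
      a + (d + (- d + - b))   ≈⟨ +-congˡ (+-assoc d (- d) (- b)) ⟨
      a + ((d + - d) + - b)   ≈⟨ +-congˡ (+-congʳ (-‿inverseʳ d)) ⟩
      a + (0# + - b)          ≈⟨ +-congˡ (+-identityˡ (- b)) ⟩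
      a - b                   ∎

    x-0≈x : ∀ x → x - 0# ≈ x
    x-0≈x x = trans (+-congˡ -0#≈0#) (+-identityʳ x)

    ⊖-homo : ∀ m n → ⟦ m ℤ.⊖ n ⟧ ≈ m · 1# - n · 1#
    ⊖-homo m       zero    = sym (x-0≈x _)
    ⊖-homo zero    (suc n) = sym (+-identityˡ _)
    ⊖-homo (suc m) (suc n) = begin
      ⟦ suc m ℤ.⊖ suc n ⟧                ≡⟨ ≡.cong ⟦_⟧ (ℤ.[1+m]⊖[1+n]≡m⊖n m n) ⟩
      ⟦ m ℤ.⊖ n ⟧                        ≈⟨ ⊖-homo m n ⟩
      m · 1# - n · 1#                    ≈⟨ cancel _ _ 1# ⟨
      (1# + m · 1#) - (1# + n · 1#)      ≈⟨ +-cong (1+× m 1#) (-‿cong (1+× n 1#)) ⟨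
      suc m · 1# - suc n · 1#            ∎

    +-homo : ∀ i j → ⟦ i ℤ.+ j ⟧ ≈ ⟦ i ⟧ + ⟦ j ⟧
    +-homo (+ m)      (+ n)      = ×-homo-+ 1# m n
    +-homo (+ m)      -[1+ n ]   = ⊖-homo m (suc n)
    +-homo -[1+ m ]   (+ n)      = trans (⊖-homo n (suc m)) (+-comm _ _)
    +-homo -[1+ m ]   -[1+ n ]   = begin
      - (suc (suc (m ℕ.+ n)) · 1#)       ≡⟨ ≡.cong (λ k → - (suc k · 1#)) (≡.sym (ℕ.+-suc m n)) ⟩
      - ((suc m ℕ.+ suc n) · 1#)         ≈⟨ -‿cong (×-homo-+ 1# (suc m) (suc n)) ⟩
      - (suc m · 1# + suc n · 1#)        ≈⟨ ⁻¹-∙-comm _ _ ⟨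
      - (suc m · 1#) + - (suc n · 1#)    ∎

    -‿homo : ∀ i → ⟦ ℤ.- i ⟧ ≈ - ⟦ i ⟧
    -‿homo (+ zero)  = sym -0#≈0#
    -‿homo (+ suc n) = refl
    -‿homo -[1+ n ]  = sym (-‿involutive _)

    *-homo : ∀ i j → ⟦ i ℤ.* j ⟧ ≈ ⟦ i ⟧ * ⟦ j ⟧
    *-homo (+ m) (+ n) =
      trans (reflexive (≡.cong ⟦_⟧ (≡.sym (ℤ.pos-* m n)))) (×1-homo-* m n)
    *-homo (+ m) -[1+ n ] = begin
      ⟦ + m ℤ.* -[1+ n ] ⟧           ≡⟨ ≡.cong ⟦_⟧ (≡.sym (ℤ.neg-distribʳ-* (+ m) (+ suc n))) ⟩
      ⟦ ℤ.- (+ m ℤ.* + suc n) ⟧      ≈⟨ -‿homo (+ m ℤ.* + suc n) ⟩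
      - ⟦ + m ℤ.* + suc n ⟧          ≈⟨ -‿cong (*-homo (+ m) (+ suc n)) ⟩
      - (m · 1# * suc n · 1#)        ≈⟨ -‿distribʳ-* _ _ ⟩
      m · 1# * - (suc n · 1#)        ∎
    *-homo -[1+ m ] (+ n) = begin
      ⟦ -[1+ m ] ℤ.* + n ⟧           ≡⟨ ≡.cong ⟦_⟧ (≡.sym (ℤ.neg-distribˡ-* (+ suc m) (+ n))) ⟩
      ⟦ ℤ.- (+ suc m ℤ.* + n) ⟧      ≈⟨ -‿homo (+ suc m ℤ.* + n) ⟩
      - ⟦ + suc m ℤ.* + n ⟧          ≈⟨ -‿cong (*-homo (+ suc m) (+ n)) ⟩
      - (suc m · 1# * n · 1#)        ≈⟨ -‿distribˡ-* _ _ ⟩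
      - (suc m · 1#) * n · 1#        ∎
    *-homo -[1+ m ] -[1+ n ] = begin
      (suc m ℕ.* suc n) · 1#                 ≈⟨ ×1-homo-* (suc m) (suc n) ⟩
      suc m · 1# * suc n · 1#                ≈⟨ -‿involutive _ ⟨
      - - (suc m · 1# * suc n · 1#)          ≈⟨ -‿cong (-‿distribˡ-* _ _) ⟩
      - (- (suc m · 1#) * suc n · 1#)        ≈⟨ -‿distribʳ-* _ _ ⟩
      - (suc m · 1#) * - (suc n · 1#)        ∎

    ℤ-rawRing : RawRing _ _
    ℤ-rawRing = CommutativeRing.rawRing ℤ.+-*-commutativeRing

    morphism : ℤ-rawRing -Raw-AlmostCommutative⟶ fromCommutativeRing R
    morphism = record
      { ⟦_⟧    = ⟦_⟧
      ; +-homo = +-homo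
      ; *-homo = *-homo
      ; -‿homo = -‿homo
      ; 0-homo = refl
      ; 1-homo = refl
      }

    -- Equality of reals cannot be decided, so coefficients are compared as integers before they are
    -- mapped into the ring.
    coefficients≟ : ∀ i j → Maybe (⟦ i ⟧ ≈ ⟦ j ⟧)
    coefficients≟ i j with i ℤ.≟ j
    ... | yes i≡j = just (reflexive (≡.cong ⟦_⟧ i≡j))
    ... | no _    = nothing

  open RingSolver ℤ-rawRing (fromCommutativeRing R) morphism coefficients≟ public
    using (solve; _:=_; _:+_; _:*_; _:-_; :-_; con; Polynomial)

-- Constructive ordered field arithmetic

module OrderedField {c ℓ₁ ℓ₂} (ℝ : Reals c ℓ₁ ℓ₂) where
  open Reals ℝ hiding (zero)
  open CommutativeRing commutativeRing using (semiring; ring) public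
  open RingProperties ring using (-0#≈0#)
  open SemiringMult semiring using (×-homo-+; ×1-homo-*)
  open SemiringExp semiring using (_^_; ^-homo-*; ^-assocʳ) public
  open IntegerSolver commutativeRing public
    using (solve; _:=_; _:+_; _:*_; _:-_; :-_; con; Polynomial)
  open IsStrictPartialOrder isStrictPartialOrder public
    using (<-resp-≈) renaming (trans to <-trans; irrefl to <-irrefl; asym to <-asym)

  :0 :1 : ∀ {n} → Polynomial n
  :0 = con (+ 0)
  :1 = con (+ 1)

  <-respʳ-≈ : ∀ {x y z} → y ≈ z → x < y → x < z
  <-respʳ-≈ = proj₁ <-resp-≈

  <-respˡ-≈ : ∀ {x y z} → y ≈ z → y < x → z < x
  <-respˡ-≈ = proj₂ <-resp-≈

  <⇒≤ : ∀ {x y} → x < y → x ≤ y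
  <⇒≤ = <-asym

  ≤-reflexive : ∀ {x y} → x ≈ y → x ≤ y
  ≤-reflexive x≈y = <-irrefl (sym x≈y)

  ≤-refl : ∀ {x} → x ≤ x
  ≤-refl = ≤-reflexive refl

  ≤-trans : ∀ {x y z} → x ≤ y → y ≤ z → x ≤ z
  ≤-trans {y = y} x≤y y≤z z<x with <-cotrans z<x y
  ... | inj₁ z<y = y≤z z<y
  ... | inj₂ y<x = x≤y y<x

  <-≤-trans : ∀ {x y z} → x < y → y ≤ z → x < z
  <-≤-trans {z = z} x<y y≤z with <-cotrans x<y z
  ... | inj₁ x<z = x<z
  ... | inj₂ z<y = ⊥-elim (y≤z z<y)

  ≤-<-trans : ∀ {x y z} → x ≤ y → y < z → x < z
  ≤-<-trans {x = x} x≤y y<z with <-cotrans y<z x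
  ... | inj₁ y<x = ⊥-elim (x≤y y<x)
  ... | inj₂ x<z = x<z

  ≤-antisym : ∀ {x y} → x ≤ y → y ≤ x → x ≈ y
  ≤-antisym {x} {y} x≤y y≤x = proj₁ (tight x y) λ x#y →
    case (Equivalence.to #⇔<⊎> x#y)
    where
    case : x < y ⊎ y < x → ⊥
    case (inj₁ x<y) = y≤x x<y
    case (inj₂ y<x) = x≤y y<x

  ≤-isPreorder : IsPreorder _≈_ _≤_
  ≤-isPreorder = record
    { isEquivalence = isEquivalence ; reflexive = ≤-reflexive ; trans = ≤-trans }

  module ≤-Reasoning = TripleReasoning ≤-isPreorder <-asym <-trans <-resp-≈
    <⇒≤ <-≤-trans ≤-<-trans

  open ≤-Reasoning

  x<y⇒0<y-x : ∀ {x y} → x < y → 0# < y - x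
  x<y⇒0<y-x {x} x<y = <-respˡ-≈ (-‿inverseʳ x) (+-monoˡ-< (- x) x<y)

  x+[y-x]≈y : ∀ x y → x + (y - x) ≈ y
  x+[y-x]≈y = solve 2 (λ x y → x :+ (y :- x) := y) refl

  +-monoʳ-< : ∀ z {x y} → x < y → z + x < z + y
  +-monoʳ-< z x<y = <-respˡ-≈ (+-comm _ z) (<-respʳ-≈ (+-comm _ z) (+-monoˡ-< z x<y))

  0<y-x⇒x<y : ∀ {x y} → 0# < y - x → x < y
  0<y-x⇒x<y {x} {y} 0<y-x =
    <-respˡ-≈ (+-identityʳ x) (<-respʳ-≈ (x+[y-x]≈y x y) (+-monoʳ-< x 0<y-x))

  +-monoˡ-≤ : ∀ z {x y} → x ≤ y → x + z ≤ y + z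
  +-monoˡ-≤ z {x} {y} x≤y y+z<x+z = x≤y (0<y-x⇒x<y
    (<-respʳ-≈ (solve 3 (λ x y z → (x :+ z) :- (y :+ z) := x :- y) refl x y z)
      (x<y⇒0<y-x y+z<x+z)))

  +-monoʳ-≤ : ∀ z {x y} → x ≤ y → z + x ≤ z + y
  +-monoʳ-≤ z {x} {y} x≤y = begin
    z + x  ≈⟨ +-comm z x ⟩
    x + z  ≤⟨ +-monoˡ-≤ z x≤y ⟩
    y + z  ≈⟨ +-comm y z ⟩
    z + y  ∎

  +-mono-≤ : ∀ {x y u v} → x ≤ y → u ≤ v → x + u ≤ y + v
  +-mono-≤ x≤y u≤v = ≤-trans (+-monoˡ-≤ _ x≤y) (+-monoʳ-≤ _ u≤v)

  +-nonneg : ∀ {x y} → 0# ≤ x → 0# ≤ y → 0# ≤ x + y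
  +-nonneg {x} {y} 0≤x 0≤y = begin
    0#       ≈⟨ +-identityʳ 0# ⟨
    0# + 0#  ≤⟨ +-mono-≤ 0≤x 0≤y ⟩
    x + y    ∎

  x≤y⇒0≤y-x : ∀ {x y} → x ≤ y → 0# ≤ y - x
  x≤y⇒0≤y-x {x} {y} x≤y = begin
    0#     ≈⟨ -‿inverseʳ x ⟨
    x - x  ≤⟨ +-monoˡ-≤ (- x) x≤y ⟩
    y - x  ∎

  x≤x+y : ∀ x {y} → 0# ≤ y → x ≤ x + y
  x≤x+y x {y} 0≤y = begin
    x       ≈⟨ +-identityʳ x ⟨
    x + 0#  ≤⟨ +-monoʳ-≤ x 0≤y ⟩
    x + y   ∎

  x-y≤x : ∀ x {y} → 0# ≤ y → x - y ≤ x
  x-y≤x x {y} 0≤y = begin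
    x - y        ≤⟨ x≤x+y (x - y) 0≤y ⟩
    x - y + y    ≈⟨ solve 2 (λ x y → x :- y :+ y := x) refl x y ⟩
    x            ∎

  ≤-by : ∀ {x y d} → 0# ≤ d → x + d ≈ y → x ≤ y
  ≤-by {x} {y} {d} 0≤d x+d≈y = ≤-trans (x≤x+y x 0≤d) (≤-reflexive x+d≈y)

  0≤y-x⇒x≤y : ∀ {x y} → 0# ≤ y - x → x ≤ y
  0≤y-x⇒x≤y {x} {y} 0≤y-x = ≤-by 0≤y-x (x+[y-x]≈y x y)

  -- The signs of `x` and `y` cannot be decided, but the goal is a negation. If xy < 0, then 0 < x
  -- would force y ≈ 0, hence xy ≈ 0; so x ≈ 0, and again xy ≈ 0.
  *-nonneg : ∀ {x y} → 0# ≤ x → 0# ≤ y → 0# ≤ x * y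
  *-nonneg {x} {y} 0≤x 0≤y xy<0 = <-irrefl xy≈0 xy<0
    where
    x≯0 : x ≤ 0#
    x≯0 0<x = <-irrefl (trans (*-congˡ y≈0) (zeroʳ x)) xy<0
      where
      y≈0 : y ≈ 0#
      y≈0 = ≤-antisym (λ 0<y → <-asym (*-pos 0<x 0<y) xy<0) 0≤y
    xy≈0 : x * y ≈ 0#
    xy≈0 = trans (*-congʳ (≤-antisym x≯0 0≤x)) (zeroˡ y)

  *-monoʳ-≤ : ∀ z {x y} → 0# ≤ z → x ≤ y → z * x ≤ z * y
  *-monoʳ-≤ z {x} {y} 0≤z x≤y = ≤-by (*-nonneg 0≤z (x≤y⇒0≤y-x x≤y))
    (solve 3 (λ x y z → z :* x :+ z :* (y :- x) := z :* y) refl x y z)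

  *-monoˡ-≤ : ∀ z {x y} → 0# ≤ z → x ≤ y → x * z ≤ y * z
  *-monoˡ-≤ z {x} {y} 0≤z x≤y = begin
    x * z  ≈⟨ *-comm x z ⟩
    z * x  ≤⟨ *-monoʳ-≤ z 0≤z x≤y ⟩
    z * y  ≈⟨ *-comm z y ⟩
    y * z  ∎

  *-mono-≤ : ∀ {x y u v} → 0# ≤ x → 0# ≤ v → x ≤ y → u ≤ v → x * u ≤ y * v
  *-mono-≤ 0≤x 0≤v x≤y u≤v = ≤-trans (*-monoʳ-≤ _ 0≤x u≤v) (*-monoˡ-≤ _ 0≤v x≤y)

  *-monoʳ-< : ∀ z {x y} → 0# < z → x < y → z * x < z * y
  *-monoʳ-< z {x} {y} 0<z x<y = 0<y-x⇒x<y (<-respʳ-≈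
    (solve 3 (λ x y z → z :* (y :- x) := z :* y :- z :* x) refl x y z)
    (*-pos 0<z (x<y⇒0<y-x x<y)))

  *-cancelˡ-≤ : ∀ z {x y} → 0# < z → z * x ≤ z * y → x ≤ y
  *-cancelˡ-≤ z 0<z zx≤zy y<x = zx≤zy (*-monoʳ-< z 0<z y<x)

  fromℕ-+ : ∀ m n → fromℕ (m ℕ.+ n) ≈ fromℕ m + fromℕ n
  fromℕ-+ = ×-homo-+ 1#

  fromℕ-* : ∀ m n → fromℕ (m ℕ.* n) ≈ fromℕ m * fromℕ n
  fromℕ-* = ×1-homo-*

  fromℕ-1 : fromℕ 1 ≈ 1#
  fromℕ-1 = +-identityʳ 1#

  0≤fromℕ : ∀ n → 0# ≤ fromℕ n
  0≤fromℕ zero    = ≤-refl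
  0≤fromℕ (suc n) = <⇒≤ (fromℕ-pos n)

  fromℕ-mono-≤ : ∀ {m n} → m ℕ.≤ n → fromℕ m ≤ fromℕ n
  fromℕ-mono-≤ {m} {n} m≤n = begin
    fromℕ m                     ≤⟨ x≤x+y _ (0≤fromℕ (n ℕ.∸ m)) ⟩
    fromℕ m + fromℕ (n ℕ.∸ m)   ≈⟨ fromℕ-+ m (n ℕ.∸ m) ⟨
    fromℕ (m ℕ.+ (n ℕ.∸ m))     ≡⟨ ≡.cong fromℕ (ℕ.m+[n∸m]≡n m≤n) ⟩
    fromℕ n                     ∎

  x<x+1 : ∀ x → x < x + 1#
  x<x+1 x = <-respˡ-≈ (+-identityʳ x) (+-monoʳ-< x 0<1)

  fromℕ-cancel-≤ : ∀ {m n} → fromℕ m ≤ fromℕ n → m ℕ.≤ n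
  fromℕ-cancel-≤ {m} {n} m≤n with ℕ.≤-<-connex m n
  ... | inj₁ p = p
  ... | inj₂ n<m = ⊥-elim (m≤n (<-≤-trans
    (<-respʳ-≈ (+-comm _ 1#) (x<x+1 (fromℕ n))) (fromℕ-mono-≤ n<m)))

  0≤1 : 0# ≤ 1#
  0≤1 = <⇒≤ 0<1

  convex-≤ : ∀ {q v x y} → 0# ≤ q → q ≤ 1# → v ≤ x → v ≤ y →
             v ≤ q * x + (1# - q) * y
  convex-≤ {q} {v} {x} {y} 0≤q q≤1 v≤x v≤y = ≤-by
    (+-nonneg (*-nonneg 0≤q (x≤y⇒0≤y-x v≤x))
              (*-nonneg (x≤y⇒0≤y-x q≤1) (x≤y⇒0≤y-x v≤y)))
    (solve 4 (λ q v x y →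
      v :+ (q :* (x :- v) :+ (:1 :- q) :* (y :- v)) := q :* x :+ (:1 :- q) :* y)
      refl q v x y)

  convex-mono-≤ : ∀ {q u v x y} → 0# ≤ q → q ≤ 1# → u ≤ x → v ≤ y →
                  q * u + (1# - q) * v ≤ q * x + (1# - q) * y
  convex-mono-≤ 0≤q q≤1 u≤x v≤y =
    +-mono-≤ (*-monoʳ-≤ _ 0≤q u≤x) (*-monoʳ-≤ _ (x≤y⇒0≤y-x q≤1) v≤y)

  ^-nonneg : ∀ {x} n → 0# ≤ x → 0# ≤ x ^ n
  ^-nonneg zero    0≤x = 0≤1
  ^-nonneg (suc n) 0≤x = *-nonneg 0≤x (^-nonneg n 0≤x)

  ^-pos : ∀ {x} n → 0# < x → 0# < x ^ n
  ^-pos zero    0<x = 0<1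
  ^-pos (suc n) 0<x = *-pos 0<x (^-pos n 0<x)

  1≤^ : ∀ {x} n → 1# ≤ x → 1# ≤ x ^ n
  1≤^ zero    1≤x = ≤-refl
  1≤^ {x} (suc n) 1≤x = begin
    1#         ≈⟨ *-identityˡ 1# ⟨
    1# * 1#    ≤⟨ *-mono-≤ 0≤1 (≤-trans 0≤1 (1≤^ n 1≤x)) 1≤x (1≤^ n 1≤x) ⟩
    x * x ^ n  ∎

  ^-monoˡ-≤ : ∀ {x y} n → 0# ≤ x → x ≤ y → x ^ n ≤ y ^ n
  ^-monoˡ-≤ zero    0≤x x≤y = ≤-refl
  ^-monoˡ-≤ (suc n) 0≤x x≤y =
    *-mono-≤ 0≤x (^-nonneg n (≤-trans 0≤x x≤y)) x≤y (^-monoˡ-≤ n 0≤x x≤y)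

  *-^-distrib : ∀ x y n → (x * y) ^ n ≈ x ^ n * y ^ n
  *-^-distrib x y zero    = sym (*-identityˡ 1#)
  *-^-distrib x y (suc n) = trans (*-congˡ (*-^-distrib x y n))
    (solve 4 (λ x y u v → x :* y :* (u :* v) := x :* u :* (y :* v)) refl
      x y (x ^ n) (y ^ n))

  fromℕ-^ : ∀ m n → fromℕ (m ℕ.^ n) ≈ fromℕ m ^ n
  fromℕ-^ m zero    = fromℕ-1
  fromℕ-^ m (suc n) = trans (fromℕ-* m (m ℕ.^ n)) (*-congˡ (fromℕ-^ m n))

  bernoulli : ∀ {x} n → 0# ≤ x → 1# + fromℕ n * x ≤ (1# + x) ^ n
  bernoulli {x} zero    0≤x = ≤-reflexive (trans (+-congˡ (zeroˡ x)) (+-identityʳ 1#))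
  bernoulli {x} (suc n) 0≤x = begin
    1# + fromℕ (suc n) * x            ≤⟨ ≤-by (*-nonneg 0≤x (*-nonneg (0≤fromℕ n) 0≤x))
      (solve 2 (λ x k → (:1 :+ (:1 :+ k) :* x) :+ x :* (k :* x) := (:1 :+ x) :* (:1 :+ k :* x))
        refl x (fromℕ n)) ⟩
    (1# + x) * (1# + fromℕ n * x)     ≤⟨ *-monoʳ-≤ _ (+-nonneg 0≤1 0≤x) (bernoulli n 0≤x) ⟩
    (1# + x) * (1# + x) ^ n           ∎

  -- Induction works because (1 - x)(1 + (n+1)x) falls short of 1 + nx by (n+1)x². It replaces the
  -- exponential estimate: once nx ≥ 1, the power is at most one half.
  bernoulli-recip : ∀ {x} n → 0# ≤ x → x ≤ 1# → (1# - x) ^ n * (1# + fromℕ n * x) ≤ 1#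
  bernoulli-recip {x} zero    0≤x x≤1 = ≤-reflexive
    (solve 1 (λ x → :1 :* (:1 :+ :0 :* x) := :1) refl x)
  bernoulli-recip {x} (suc n) 0≤x x≤1 = begin
    (1# - x) ^ suc n * (1# + fromℕ (suc n) * x)  ≤⟨ ≤-by
      (*-nonneg (^-nonneg n (x≤y⇒0≤y-x x≤1)) (*-nonneg (0≤fromℕ (suc n)) (*-nonneg 0≤x 0≤x)))
      (solve 3 (λ x k y → (:1 :- x) :* y :* (:1 :+ (:1 :+ k) :* x) :+ y :* ((:1 :+ k) :* (x :* x))
        := y :* (:1 :+ k :* x)) refl x (fromℕ n) ((1# - x) ^ n)) ⟩
    (1# - x) ^ n * (1# + fromℕ n * x)            ≤⟨ bernoulli-recip n 0≤x x≤1 ⟩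
    1#                                           ∎

  -- The least integer above `x` cannot be computed. Descending from an Archimedean bound,
  -- cotransitivity on x < x + 1 tells at each integer whether to go on or to stop; the price is a
  -- slack of 2 instead of 1.
  ceiling : ∀ {x} → 0# ≤ x → ∃[ n ] x < fromℕ (suc n) × fromℕ (suc n) < x + fromℕ 2
  ceiling {x} 0≤x with archimedean x
  ... | n , x<n = search n x<n
    where
    search : ∀ n → x < fromℕ n → ∃[ m ] x < fromℕ (suc m) × fromℕ (suc m) < x + fromℕ 2
    search zero    x<0 = ⊥-elim (0≤x x<0)
    search (suc n) x<1+n with <-cotrans (x<x+1 x) (fromℕ n)
    ... | inj₁ x<n   = search n x<n
    ... | inj₂ n<x+1 = n , x<1+n , <-respʳ-≈
      (solve 1 (λ x → :1 :+ (x :+ :1) := x :+ (:1 :+ (:1 :+ :0))) refl x)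
      (+-monoʳ-< 1# n<x+1)

  sum-nonneg : ∀ {n} (f : Fin n → Carrier) → (∀ i → 0# ≤ f i) → 0# ≤ sum f
  sum-nonneg {zero}  f 0≤f = ≤-refl
  sum-nonneg {suc n} f 0≤f = +-nonneg (0≤f zero) (sum-nonneg _ (λ i → 0≤f (suc i)))

  term≤sum : ∀ {n} (f : Fin n → Carrier) → (∀ i → 0# ≤ f i) → ∀ i → f i ≤ sum f
  term≤sum f 0≤f zero    = x≤x+y _ (sum-nonneg _ (λ i → 0≤f (suc i)))
  term≤sum f 0≤f (suc i) = begin
    f (suc i)                    ≤⟨ term≤sum (λ j → f (suc j)) (λ j → 0≤f (suc j)) i ⟩
    sum (λ j → f (suc j))        ≤⟨ x≤x+y _ (0≤f zero) ⟩
    sum (λ j → f (suc j)) + f zero ≈⟨ +-comm _ _ ⟩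
    sum f                        ∎

  recip-inverseʳ : ∀ x (0<x : 0# < x) → x * recip x 0<x ≈ 1#
  recip-inverseʳ x 0<x = trans (*-comm _ _) (recip-inverseˡ x 0<x)

  ½ : Carrier
  ½ = recip (fromℕ 2) (fromℕ-pos 1)

  0<½ : 0# < ½
  0<½ = recip-pos (fromℕ 2) (fromℕ-pos 1)

  0≤½^ : ∀ n → 0# ≤ ½ ^ n
  0≤½^ n = ^-nonneg n (<⇒≤ 0<½)

  2^n*½^n≈1 : ∀ n → fromℕ (2 ℕ.^ n) * ½ ^ n ≈ 1#
  2^n*½^n≈1 zero = trans (*-identityʳ _) fromℕ-1
  2^n*½^n≈1 (suc n) = begin-equality
    fromℕ (2 ℕ.* 2 ℕ.^ n) * (½ * ½ ^ n)          ≈⟨ *-congʳ (fromℕ-* 2 (2 ℕ.^ n)) ⟩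
    fromℕ 2 * fromℕ (2 ℕ.^ n) * (½ * ½ ^ n)
      ≈⟨ solve 4 (λ a b c d → a :* b :* (c :* d) := a :* c :* (b :* d)) refl _ _ _ _ ⟩
    fromℕ 2 * ½ * (fromℕ (2 ℕ.^ n) * ½ ^ n)
      ≈⟨ *-cong (recip-inverseʳ (fromℕ 2) (fromℕ-pos 1)) (2^n*½^n≈1 n) ⟩
    1# * 1#                                       ≈⟨ *-identityˡ 1# ⟩
    1#                                            ∎

-- Towers of twos and the binary logarithm

tower : ℕ → ℕ
tower zero    = 1
tower (suc k) = 2 ℕ.^ tower k

module Logarithm {c ℓ₁ ℓ₂} (ℝ : Reals c ℓ₁ ℓ₂) (log : BinaryLogarithm ℝ) where
  open Reals ℝ hiding (zero)
  open OrderedField ℝ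
  open BinaryLogarithm log
  open ≤-Reasoning

  -- In particular the value does not depend on the positivity proof that `log₂` takes as an
  -- argument.
  log₂-cong : ∀ {x y} (x>0 : 0# < x) (y>0 : 0# < y) → x ≈ y → log₂ x x>0 ≈ log₂ y y>0
  log₂-cong x>0 y>0 x≈y = ≤-antisym
    (log₂-mono-≤ x>0 y>0 (≤-reflexive x≈y))
    (log₂-mono-≤ y>0 x>0 (≤-reflexive (sym x≈y)))

  log₂-1 : log₂ 1# 0<1 ≈ 0#
  log₂-1 = begin-equality
    l          ≈⟨ solve 1 (λ l → l := l :+ l :- l) refl l ⟩
    l + l - l  ≈⟨ +-congʳ (log₂-* 0<1 0<1) ⟨
    log₂ (1# * 1#) (*-pos 0<1 0<1) - l
               ≈⟨ +-congʳ (log₂-cong _ _ (*-identityˡ 1#)) ⟩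
    l - l      ≈⟨ -‿inverseʳ l ⟩
    0#         ∎
    where l = log₂ 1# 0<1

  log₂-^ : ∀ {x} (x>0 : 0# < x) n → log₂ (x ^ n) (^-pos n x>0) ≈ fromℕ n * log₂ x x>0
  log₂-^ x>0 zero = trans log₂-1 (sym (zeroˡ _))
  log₂-^ {x} x>0 (suc n) = begin-equality
    log₂ (x * x ^ n) _                     ≈⟨ log₂-* x>0 (^-pos n x>0) ⟩
    log₂ x x>0 + log₂ (x ^ n) (^-pos n x>0) ≈⟨ +-congˡ (log₂-^ x>0 n) ⟩
    log₂ x x>0 + fromℕ n * log₂ x x>0
      ≈⟨ solve 2 (λ l k → l :+ k :* l := (:1 :+ k) :* l) refl (log₂ x x>0) (fromℕ n) ⟩
    fromℕ (suc n) * log₂ x x>0             ∎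

  log₂-2^ : ∀ n (2^n>0 : 0# < fromℕ (2 ℕ.^ n)) → log₂ (fromℕ (2 ℕ.^ n)) 2^n>0 ≈ fromℕ n
  log₂-2^ n 2^n>0 = begin-equality
    log₂ (fromℕ (2 ℕ.^ n)) _   ≈⟨ log₂-cong _ _ (fromℕ-^ 2 n) ⟩
    log₂ (fromℕ 2 ^ n) _       ≈⟨ log₂-^ (fromℕ-pos 1) n ⟩
    fromℕ n * log₂ (fromℕ 2) _ ≈⟨ *-congˡ log₂-2 ⟩
    fromℕ n * 1#               ≈⟨ *-identityʳ _ ⟩
    fromℕ n                    ∎

  -- By Bernoulli's inequality xⁿ ≥ 2.
  1≤n*log₂ : ∀ {x s} (x>0 : 0# < x) n → 0# ≤ s → 1# ≤ fromℕ n * s → 1# + s ≤ x →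
             1# ≤ fromℕ n * log₂ x x>0
  1≤n*log₂ {x} {s} x>0 n 0≤s 1≤ns 1+s≤x = begin
    1#                             ≈⟨ log₂-2 ⟨
    log₂ (fromℕ 2) (fromℕ-pos 1)   ≤⟨ log₂-mono-≤ _ (^-pos n x>0) 2≤x^n ⟩
    log₂ (x ^ n) (^-pos n x>0)     ≈⟨ log₂-^ x>0 n ⟩
    fromℕ n * log₂ x x>0           ∎
    where
    2≤x^n : fromℕ 2 ≤ x ^ n
    2≤x^n = begin
      fromℕ 2             ≈⟨ +-congˡ fromℕ-1 ⟩
      1# + 1#             ≤⟨ +-monoʳ-≤ 1# 1≤ns ⟩
      1# + fromℕ n * s    ≤⟨ bernoulli n 0≤s ⟩
      (1# + s) ^ n        ≤⟨ ^-monoˡ-≤ n (+-nonneg 0≤1 0≤s) 1+s≤x ⟩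
      x ^ n               ∎

  0≤log₂ : ∀ {x} (x>0 : 0# < x) → 1# ≤ x → 0# ≤ log₂ x x>0
  0≤log₂ x>0 1≤x = ≤-trans (≤-reflexive (sym log₂-1)) (log₂-mono-≤ 0<1 x>0 1≤x)

  -- Monotonicity is given only for `_≤_`. Strictness comes from the Archimedean property: some
  -- power of `x` reaches 2, whose logarithm is 1.
  1<x⇒log₂≰0 : ∀ {x} (x>0 : 0# < x) → 1# < x → ¬ (log₂ x x>0 ≤ 0#)
  1<x⇒log₂≰0 {x} x>0 1<x log≤0 with archimedean (recip (x - 1#) (x<y⇒0<y-x 1<x))
  ... | n , s⁻¹<n = absurd 0<1
    where
    s = x - 1#
    0<s : 0# < s
    0<s = x<y⇒0<y-x 1<x
    1≤ns : 1# ≤ fromℕ n * s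
    1≤ns = begin
      1#                ≈⟨ recip-inverseˡ s 0<s ⟨
      recip s 0<s * s   ≤⟨ *-monoˡ-≤ s (<⇒≤ 0<s) (<⇒≤ s⁻¹<n) ⟩
      fromℕ n * s       ∎
    absurd : 1# ≤ 0#
    absurd = begin
      1#                     ≤⟨ 1≤n*log₂ x>0 n (<⇒≤ 0<s) 1≤ns (≤-reflexive (x+[y-x]≈y 1# x)) ⟩
      fromℕ n * log₂ x x>0   ≤⟨ *-monoʳ-≤ _ (0≤fromℕ n) log≤0 ⟩
      fromℕ n * 0#           ≈⟨ zeroʳ _ ⟩
      0#                     ∎

  -- Otherwise the quotient of `x` by 2^n would exceed 1 while its logarithm is at most 0.
  log₂≤⇒≤2^ : ∀ {x} (x>0 : 0# < x) n → log₂ x x>0 ≤ fromℕ n → x ≤ fromℕ (2 ℕ.^ n)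
  log₂≤⇒≤2^ {x} x>0 n log≤n 2^n<x = 1<x⇒log₂≰0 z>0 1<z logz≤0
    where
    y = fromℕ (2 ℕ.^ n)
    y>0 : 0# < y
    y>0 = <-respʳ-≈ (sym (fromℕ-^ 2 n)) (^-pos n (fromℕ-pos 1))
    z = recip y y>0 * x
    z>0 : 0# < z
    z>0 = *-pos (recip-pos y y>0) x>0
    1<z : 1# < z
    1<z = <-respˡ-≈ (recip-inverseˡ y y>0) (*-monoʳ-< _ (recip-pos y y>0) 2^n<x)
    yz≈x : y * z ≈ x
    yz≈x = trans (sym (*-assoc y _ x))
      (trans (*-congʳ (recip-inverseʳ y y>0)) (*-identityˡ x))
    logz≤0 : log₂ z z>0 ≤ 0#
    logz≤0 = begin
      log₂ z z>0                            ≈⟨ solve 2 (λ a b → a := b :+ a :- b) refl _ (log₂ y y>0) ⟩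
      log₂ y y>0 + log₂ z z>0 - log₂ y y>0  ≈⟨ +-congʳ (log₂-* y>0 z>0) ⟨
      log₂ (y * z) _ - log₂ y y>0           ≈⟨ +-cong (log₂-cong _ x>0 yz≈x) (-‿cong (log₂-2^ n y>0)) ⟩
      log₂ x x>0 - fromℕ n                  ≤⟨ +-monoˡ-≤ _ log≤n ⟩
      fromℕ n - fromℕ n                     ≈⟨ -‿inverseʳ _ ⟩
      0#                                    ∎

  IsLog*⇒≤tower : ∀ {x k} → IsLog* x k → x ≤ fromℕ (tower k)
  IsLog*⇒≤tower {k = zero}  (stop x≤1)        = ≤-trans x≤1 (≤-reflexive (sym fromℕ-1))
  IsLog*⇒≤tower {k = suc k} (step x>0 _ log*) = log₂≤⇒≤2^ x>0 (tower k) (IsLog*⇒≤tower log*)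

-- Choice of the numerical parameters

module Parameters {c ℓ₁ ℓ₂} (ℝ : Reals c ℓ₁ ℓ₂) (log : BinaryLogarithm ℝ) where
  open Reals ℝ hiding (zero)
  open OrderedField ℝ
  open Logarithm ℝ log
  open BinaryLogarithm log
  open ≤-Reasoning

  -- No instance has gap above 1, so R = 0 will do for Δ > 1.
  tossesPerBit : ∃[ c ] ∀ Δ (Δ>0 : 0# < Δ) → ∃[ R ]
    fromℕ R ≤ fromℕ c * recip (Δ * Δ) (*-pos Δ>0 Δ>0) ×
    (Δ ≤ 1# → fromℕ 4 ≤ fromℕ R * (Δ * Δ))
  -- With y = 1/Δ², `R` is below 4y + 2. For Δ < 2 one has 1 ≤ 4y, so three times 4y is enough.
  tossesPerBit = 12 , perBit
    where
    perBit : ∀ Δ (Δ>0 : 0# < Δ) → ∃[ R ]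
      fromℕ R ≤ fromℕ 12 * recip (Δ * Δ) (*-pos Δ>0 Δ>0) ×
      (Δ ≤ 1# → fromℕ 4 ≤ fromℕ R * (Δ * Δ))
    perBit Δ Δ>0 = byCases (<-cotrans (+-monoʳ-< 1# (<-respʳ-≈ (sym fromℕ-1) 0<1)) Δ)
      where
      Δ²>0 : 0# < Δ * Δ
      Δ²>0 = *-pos Δ>0 Δ>0
      y = recip (Δ * Δ) Δ²>0
      0≤y : 0# ≤ y
      0≤y = <⇒≤ (recip-pos _ Δ²>0)
      0≤4y : 0# ≤ fromℕ 4 * y
      0≤4y = *-nonneg (0≤fromℕ 4) 0≤y
      byCases : 1# + 0# < Δ ⊎ Δ < fromℕ 2 → ∃[ R ]
        fromℕ R ≤ fromℕ 12 * y × (Δ ≤ 1# → fromℕ 4 ≤ fromℕ R * (Δ * Δ))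
      byCases (inj₁ 1<Δ) =
        0 , *-nonneg (0≤fromℕ 12) 0≤y , λ Δ≤1 → ⊥-elim (Δ≤1 (<-respˡ-≈ fromℕ-1 1<Δ))
      byCases (inj₂ Δ<2) with ceiling 0≤4y
      ... | r , 4y<R , R<4y+2 = suc r , R≤12y , λ _ → 4≤RΔ²
        where
        1≤4y : 1# ≤ fromℕ 4 * y
        1≤4y = begin
          1#                     ≈⟨ recip-inverseˡ _ Δ²>0 ⟨
          y * (Δ * Δ)            ≤⟨ *-monoʳ-≤ y 0≤y (*-mono-≤ (<⇒≤ Δ>0) (0≤fromℕ 2) (<⇒≤ Δ<2) (<⇒≤ Δ<2)) ⟩
          y * (fromℕ 2 * fromℕ 2)
            ≈⟨ *-comm _ _ ⟩
          fromℕ 2 * fromℕ 2 * y  ≈⟨ *-congʳ (fromℕ-* 2 2) ⟨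
          fromℕ 4 * y            ∎
        R≤12y : fromℕ (suc r) ≤ fromℕ 12 * y
        R≤12y = begin
          fromℕ (suc r)                                 ≤⟨ <⇒≤ R<4y+2 ⟩
          fromℕ 4 * y + fromℕ 2                         ≈⟨ +-congˡ (*-identityʳ _) ⟨
          fromℕ 4 * y + fromℕ 2 * 1#                    ≤⟨ +-monoʳ-≤ _ (*-monoʳ-≤ _ (0≤fromℕ 2) 1≤4y) ⟩
          fromℕ 4 * y + fromℕ 2 * (fromℕ 4 * y)
            ≈⟨ solve 1 (λ z → z :+ (:1 :+ (:1 :+ :0)) :* z := (:1 :+ (:1 :+ (:1 :+ :0))) :* z) refl _ ⟩
          fromℕ 3 * (fromℕ 4 * y)                       ≈⟨ *-assoc _ _ _ ⟨
          fromℕ 3 * fromℕ 4 * y                         ≈⟨ *-congʳ (fromℕ-* 3 4) ⟨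
          fromℕ 12 * y                                  ∎
        4≤RΔ² : fromℕ 4 ≤ fromℕ (suc r) * (Δ * Δ)
        4≤RΔ² = begin
          fromℕ 4                    ≈⟨ *-identityʳ _ ⟨
          fromℕ 4 * 1#               ≈⟨ *-congˡ (recip-inverseˡ _ Δ²>0) ⟨
          fromℕ 4 * (y * (Δ * Δ))    ≈⟨ *-assoc _ _ _ ⟨
          fromℕ 4 * y * (Δ * Δ)      ≤⟨ *-monoˡ-≤ _ (<⇒≤ Δ²>0) (<⇒≤ 4y<R) ⟩
          fromℕ (suc r) * (Δ * Δ)    ∎

  -- Searching one of B equal windows with error 2⁻ᴰ succeeds with probability
  -- at least (1 - 2⁻ᴰ)/B.  When δ is near 1 the toss budget is too small to
  -- search the whole stream, and B ~ 1/(1 - δ); otherwise B = 1.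
  windowsAndBits : ∃[ c ] ∀ δ (δ>0 : 0# < δ) → δ < 1# → ∃[ b ] ∃[ d ]
    fromℕ (suc b) * (1# - δ) ≤ 1# - ½ ^ suc d ×
    fromℕ (suc d) ≤ fromℕ c * (fromℕ (suc b) * log₂ (recip δ δ>0) (recip-pos δ δ>0))
  -- 17 = 1 + 2 · 8: for 1 - δ > 1/8 the number of bits is below L + 2, and 1 ≤ 8L. The other case
  -- needs only 8.
  windowsAndBits = 17 , windowsFor
    where
    windowsFor : ∀ δ (δ>0 : 0# < δ) → δ < 1# → ∃[ b ] ∃[ d ]
      fromℕ (suc b) * (1# - δ) ≤ 1# - ½ ^ suc d ×
      fromℕ (suc d) ≤ fromℕ 17 * (fromℕ (suc b) * log₂ (recip δ δ>0) (recip-pos δ δ>0))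
    -- The thresholds 1/8 and 1/4 overlap, so one of 1/8 < s and s < 1/4 can be established.
    windowsFor δ δ>0 δ<1 = byCases (<-cotrans (*-monoʳ-< ½ 0<½ ½²<½) s)
      where
      s = 1# - δ
      0<s : 0# < s
      0<s = x<y⇒0<y-x δ<1
      δ⁻¹ = recip δ δ>0
      δ⁻¹>0 : 0# < δ⁻¹
      δ⁻¹>0 = recip-pos δ δ>0
      L = log₂ δ⁻¹ δ⁻¹>0
      1+s≤δ⁻¹ : 1# + s ≤ δ⁻¹
      1+s≤δ⁻¹ = *-cancelˡ-≤ δ δ>0 (begin
        δ * (1# + s)   ≤⟨ ≤-by (*-nonneg (<⇒≤ 0<s) (<⇒≤ 0<s))
          (solve 1 (λ d → d :* (:1 :+ (:1 :- d)) :+ (:1 :- d) :* (:1 :- d) := :1) refl δ) ⟩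
        1#             ≈⟨ recip-inverseʳ δ δ>0 ⟨
        δ * δ⁻¹        ∎)
      0≤L : 0# ≤ L
      0≤L = 0≤log₂ δ⁻¹>0 (≤-trans (x≤x+y 1# (<⇒≤ 0<s)) 1+s≤δ⁻¹)
      ½²<½ : ½ ^ 2 < ½ ^ 1
      ½²<½ = *-monoʳ-< ½ 0<½ (0<y-x⇒x<y (<-respʳ-≈ eq 0<½))
        where
        eq : ½ ≈ 1# - ½ * 1#
        eq = begin-equality
          ½                          ≈⟨ solve 1 (λ h → h := (:1 :+ (:1 :+ :0)) :* h :- h :* :1) refl ½ ⟩
          fromℕ 2 * ½ - ½ * 1#       ≈⟨ +-congʳ (recip-inverseʳ (fromℕ 2) (fromℕ-pos 1)) ⟩
          1# - ½ * 1#                ∎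
      byCases : ½ ^ 3 < s ⊎ s < ½ ^ 2 → ∃[ b ] ∃[ d ]
        fromℕ (suc b) * s ≤ 1# - ½ ^ suc d × fromℕ (suc d) ≤ fromℕ 17 * (fromℕ (suc b) * L)
      byCases (inj₁ ⅛<s) = 0 , d , success , cost
        where
        d : ℕ
        d = proj₁ (ceiling 0≤L)
        L<D : L < fromℕ (suc d)
        L<D = proj₁ (proj₂ (ceiling 0≤L))
        D<L+2 : fromℕ (suc d) < L + fromℕ 2
        D<L+2 = proj₂ (proj₂ (ceiling 0≤L))
        D = suc d
        ½^D≤δ : ½ ^ D ≤ δ
        ½^D≤δ = begin
          ½ ^ D                       ≈⟨ *-identityʳ _ ⟨
          ½ ^ D * 1#                  ≈⟨ *-congˡ (recip-inverseʳ δ δ>0) ⟨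
          ½ ^ D * (δ * δ⁻¹)
            ≤⟨ *-monoʳ-≤ _ (0≤½^ D) (*-monoʳ-≤ δ (<⇒≤ δ>0) (log₂≤⇒≤2^ δ⁻¹>0 D (<⇒≤ L<D))) ⟩
          ½ ^ D * (δ * fromℕ (2 ℕ.^ D))
            ≈⟨ solve 3 (λ h d k → h :* (d :* k) := d :* (k :* h)) refl _ _ _ ⟩
          δ * (fromℕ (2 ℕ.^ D) * ½ ^ D)   ≈⟨ *-congˡ (2^n*½^n≈1 D) ⟩
          δ * 1#                      ≈⟨ *-identityʳ δ ⟩
          δ                           ∎
        success : fromℕ 1 * s ≤ 1# - ½ ^ D
        success = ≤-by (x≤y⇒0≤y-x ½^D≤δ)
          (solve 2 (λ d h → (:1 :+ :0) :* (:1 :- d) :+ (d :- h) := :1 :- h) refl δ (½ ^ D))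
        1≤8L : 1# ≤ fromℕ 8 * L
        1≤8L = 1≤n*log₂ δ⁻¹>0 8 (<⇒≤ 0<s) (begin
          1#                 ≈⟨ 2^n*½^n≈1 3 ⟨
          fromℕ 8 * ½ ^ 3    ≤⟨ *-monoʳ-≤ _ (0≤fromℕ 8) (<⇒≤ ⅛<s) ⟩
          fromℕ 8 * s        ∎) 1+s≤δ⁻¹
        cost : fromℕ D ≤ fromℕ 17 * (fromℕ 1 * L)
        cost = begin
          fromℕ D                          ≤⟨ <⇒≤ D<L+2 ⟩
          L + fromℕ 2                      ≈⟨ +-congˡ (*-identityʳ _) ⟨
          L + fromℕ 2 * 1#                 ≤⟨ +-monoʳ-≤ L (*-monoʳ-≤ _ (0≤fromℕ 2) 1≤8L) ⟩
          L + fromℕ 2 * (fromℕ 8 * L)      ≈⟨ +-congˡ (*-assoc _ _ _) ⟨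
          L + fromℕ 2 * fromℕ 8 * L        ≈⟨ +-congˡ (*-congʳ (fromℕ-* 2 8)) ⟨
          L + fromℕ 16 * L                 ≈⟨ solve 2 (λ l k → l :+ k :* l := (:1 :+ k) :* ((:1 :+ :0) :* l)) refl _ _ ⟩
          fromℕ 17 * (fromℕ 1 * L)         ∎
      byCases (inj₂ s<¼) = b , 1 , success , cost
        where
        s⁻¹ = recip s 0<s
        0≤y : 0# ≤ s⁻¹ * ½ ^ 2
        0≤y = *-nonneg (<⇒≤ (recip-pos s 0<s)) (0≤½^ 2)
        b : ℕ
        b = proj₁ (ceiling 0≤y)
        y<B : s⁻¹ * ½ ^ 2 < fromℕ (suc b)
        y<B = proj₁ (proj₂ (ceiling 0≤y))
        B<y+2 : fromℕ (suc b) < s⁻¹ * ½ ^ 2 + fromℕ 2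
        B<y+2 = proj₂ (proj₂ (ceiling 0≤y))
        ys≈¼ : s⁻¹ * ½ ^ 2 * s ≈ ½ ^ 2
        ys≈¼ = begin-equality
          s⁻¹ * ½ ^ 2 * s     ≈⟨ solve 3 (λ a b c → a :* b :* c := (a :* c) :* b) refl _ _ _ ⟩
          s⁻¹ * s * ½ ^ 2     ≈⟨ *-congʳ (recip-inverseˡ s 0<s) ⟩
          1# * ½ ^ 2          ≈⟨ *-identityˡ _ ⟩
          ½ ^ 2               ∎
        B = suc b
        -- y · s is exactly 1/4, and rounding y up to `B` adds at most 2s < 1/2. The total stays
        -- below 3/4, so two bits suffice.
        success : fromℕ B * s ≤ 1# - ½ ^ 2
        success = begin
          fromℕ B * s                         ≤⟨ *-monoˡ-≤ s (<⇒≤ 0<s) (<⇒≤ B<y+2) ⟩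
          (s⁻¹ * ½ ^ 2 + fromℕ 2) * s         ≈⟨ distribʳ _ _ _ ⟩
          s⁻¹ * ½ ^ 2 * s + fromℕ 2 * s       ≤⟨ +-mono-≤ (≤-reflexive ys≈¼) (*-monoʳ-≤ _ (0≤fromℕ 2) (<⇒≤ s<¼)) ⟩
          ½ ^ 2 + fromℕ 2 * ½ ^ 2
            ≈⟨ solve 1 (λ h → h :+ (:1 :+ (:1 :+ :0)) :* h := (:1 :+ (:1 :+ (:1 :+ (:1 :+ :0)))) :* h :- h) refl _ ⟩
          fromℕ 4 * ½ ^ 2 - ½ ^ 2             ≈⟨ +-congʳ (2^n*½^n≈1 2) ⟩
          1# - ½ ^ 2                          ∎
        1≤4BL : 1# ≤ fromℕ (4 ℕ.* B) * L
        1≤4BL = 1≤n*log₂ δ⁻¹>0 (4 ℕ.* B) (<⇒≤ 0<s) (begin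
          1#                            ≈⟨ 2^n*½^n≈1 2 ⟨
          fromℕ 4 * ½ ^ 2               ≈⟨ *-congˡ ys≈¼ ⟨
          fromℕ 4 * (s⁻¹ * ½ ^ 2 * s)   ≤⟨ *-monoʳ-≤ _ (0≤fromℕ 4) (*-monoˡ-≤ s (<⇒≤ 0<s) (<⇒≤ y<B)) ⟩
          fromℕ 4 * (fromℕ B * s)       ≈⟨ *-assoc _ _ _ ⟨
          fromℕ 4 * fromℕ B * s         ≈⟨ *-congʳ (fromℕ-* 4 B) ⟨
          fromℕ (4 ℕ.* B) * s           ∎) 1+s≤δ⁻¹
        cost : fromℕ 2 ≤ fromℕ 17 * (fromℕ B * L)
        cost = begin
          fromℕ 2                            ≈⟨ *-identityʳ _ ⟨
          fromℕ 2 * 1#                       ≤⟨ *-monoʳ-≤ _ (0≤fromℕ 2) 1≤4BL ⟩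
          fromℕ 2 * (fromℕ (4 ℕ.* B) * L)    ≈⟨ *-congˡ (*-congʳ (fromℕ-* 4 B)) ⟩
          fromℕ 2 * (fromℕ 4 * fromℕ B * L)
            ≈⟨ solve 4 (λ a b c l → a :* (b :* c :* l) := a :* b :* (c :* l)) refl _ _ _ _ ⟩
          fromℕ 2 * fromℕ 4 * (fromℕ B * L)  ≈⟨ *-congʳ (fromℕ-* 2 4) ⟨
          fromℕ 8 * (fromℕ B * L)
            ≤⟨ *-monoˡ-≤ _ (*-nonneg (0≤fromℕ B) 0≤L) (fromℕ-mono-≤ (ℕ.m≤m+n 8 9)) ⟩
          fromℕ 17 * (fromℕ B * L)           ∎

-- Tournament strategies, their tosses and their memory

maximum-lub : ∀ {n m} (f : Fin n → ℕ) → (∀ i → f i ℕ.≤ m) → maximum f ℕ.≤ m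
maximum-lub {zero}  f f≤m = ℕ.z≤n
maximum-lub {suc n} f f≤m = ℕ.⊔-lub (f≤m zero) (maximum-lub _ (λ i → f≤m (suc i)))

tally : Bool → ℕ → ℕ
tally true  = suc
tally false = λ x → x

-- The verdict is an explicit argument so that proofs can split on it. In `compare`, `inj₁` includes
-- the tie, which thus goes to stored coin 1.
keepLarger : ∀ {a b} {A : Set a} {B : Set b} {u k} →
             A ⊎ B → Strategy u (suc k) → Strategy u (suc (suc k))
keepLarger (inj₁ _) = discard zero
keepLarger (inj₂ _) = discard (suc zero)

-- x and y count the heads so far of the stored coins 0 and 1.
compare : ∀ {u k} → ℕ → (x y : ℕ) → Strategy u (suc k) → Strategy u (suc (suc k))
compare zero    x y s = keepLarger (ℕ.≤-<-connex x y) s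
compare (suc r) x y s =
  tossStored zero λ h → tossStored (suc zero) λ h′ → compare r (tally h x) (tally h′ y) s

tosses-keepLarger : ∀ {a b} {A : Set a} {B : Set b} {u k} (v : A ⊎ B)
                    (s : Strategy u (suc k)) → tosses (keepLarger v s) ≡ tosses s
tosses-keepLarger (inj₁ _) s = ≡.refl
tosses-keepLarger (inj₂ _) s = ≡.refl

tosses-compare : ∀ {u k} r x y (s : Strategy u (suc k)) →
                 tosses (compare r x y s) ℕ.≤ 2 ℕ.* r ℕ.+ tosses s
tosses-compare zero    x y s = ℕ.≤-reflexive (tosses-keepLarger (ℕ.≤-<-connex x y) s)
tosses-compare (suc r) x y s = ℕ.≤-trans
  (ℕ.s≤s (ℕ.⊔-lub (ℕ.s≤s (ℕ.⊔-lub (IH true true) (IH true false)))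
                  (ℕ.s≤s (ℕ.⊔-lub (IH false true) (IH false false)))))
  (ℕ.≤-reflexive (arith r (tosses s)))
  where
  IH : ∀ h h′ → tosses (compare r (tally h x) (tally h′ y) s) ℕ.≤ 2 ℕ.* r ℕ.+ tosses s
  IH h h′ = tosses-compare r (tally h x) (tally h′ y) s
  arith : ∀ r t → suc (suc (2 ℕ.* r ℕ.+ t)) ≡ 2 ℕ.* suc r ℕ.+ t
  arith = solve-∀

memory-compare : ∀ {u k M} r x y (s : Strategy u (suc k)) → suc (suc k) ℕ.≤ M →
                 memory s ℕ.≤ M → memory (compare r x y s) ℕ.≤ M
memory-compare zero x y s k≤M s≤M = memory-keepLarger (ℕ.≤-<-connex x y)
  where
  memory-keepLarger : ∀ v → memory (keepLarger v s) ℕ.≤ _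
  memory-keepLarger (inj₁ _) = ℕ.⊔-lub k≤M s≤M
  memory-keepLarger (inj₂ _) = ℕ.⊔-lub k≤M s≤M
memory-compare {M = M} (suc r) x y s k≤M s≤M =
  ℕ.⊔-lub k≤M (ℕ.⊔-lub (ℕ.⊔-lub k≤M (ℕ.⊔-lub (IH true true) (IH true false)))
                       (ℕ.⊔-lub k≤M (ℕ.⊔-lub (IH false true) (IH false false))))
  where
  IH : ∀ h h′ → memory (compare r (tally h x) (tally h′ y) s) ℕ.≤ M
  IH h h′ = memory-compare r (tally h x) (tally h′ y) s k≤M s≤M

-- A Tree a b knocks out all but one of the a ∸ b coins that arrive while the
-- number of coins still to pass decreases from a to b.  The label of a join
-- determines the number of tosses used to compare its two champions.
data Tree : ℕ → ℕ → Set where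
  leaf : ∀ {u} → Tree (suc u) u
  join : ∀ {a b c} → ℕ → Tree a b → Tree b c → Tree a c

-- The champion of the left subtree is stored while the right one is run.
register : ∀ {a b} → Tree a b → ℕ
register leaf         = 1
register (join _ l r) = register l ⊔ suc (register r)

-- suc w because D + w ≤ D * suc w for D ≥ 1.
weight : ∀ {a b} → Tree a b → ℕ
weight leaf         = 0
weight (join w l r) = suc w ℕ.+ (weight l ℕ.+ weight r)

rest : ∀ {a} {A : Set a} {u v} → Tree u v → Vec A u → Vec A v
rest leaf         (_ ∷ xs) = xs
rest (join _ l r) xs       = rest r (rest l xs)

module _ (rounds : ℕ → ℕ) where

  -- The remainder of the strategy is passed as a continuation. Champions are pushed in front of the
  -- memory, so at a join coin 0 is the right champion and coin 1 the left one.
  run : ∀ {a b k} → Tree a b → Strategy b (suc k) → Strategy a k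
  run leaf         s = store (next s)
  run (join w l r) s = run l (run r (compare (rounds w) 0 0 s))

  tosses-run : ∀ {a b k} K (t : Tree a b) (s : Strategy b (suc k)) →
               (∀ w → 2 ℕ.* rounds w ℕ.≤ K ℕ.* suc w) →
               tosses (run t s) ℕ.≤ K ℕ.* weight t ℕ.+ tosses s
  tosses-run K leaf s rounds≤ = ℕ.m≤n+m (tosses s) (K ℕ.* 0)
  tosses-run K (join w l r) s rounds≤ = begin
    tosses (run l (run r s′))                      ≤⟨ tosses-run K l (run r s′) rounds≤ ⟩
    K ℕ.* weight l ℕ.+ tosses (run r s′)           ≤⟨ ℕ.+-monoʳ-≤ (K ℕ.* weight l) (tosses-run K r s′ rounds≤) ⟩
    K ℕ.* weight l ℕ.+ (K ℕ.* weight r ℕ.+ tosses s′)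
      ≤⟨ ℕ.+-monoʳ-≤ (K ℕ.* weight l) (ℕ.+-monoʳ-≤ (K ℕ.* weight r)
           (ℕ.≤-trans (tosses-compare (rounds w) 0 0 s) (ℕ.+-monoˡ-≤ (tosses s) (rounds≤ w)))) ⟩
    K ℕ.* weight l ℕ.+ (K ℕ.* weight r ℕ.+ (K ℕ.* suc w ℕ.+ tosses s))
      ≡⟨ arith K (weight l) (weight r) (suc w) (tosses s) ⟩
    K ℕ.* weight (join w l r) ℕ.+ tosses s         ∎
    where
    open ℕ.≤-Reasoning
    s′ = compare (rounds w) 0 0 s
    arith : ∀ K l r w t → K ℕ.* l ℕ.+ (K ℕ.* r ℕ.+ (K ℕ.* w ℕ.+ t)) ≡ K ℕ.* (w ℕ.+ (l ℕ.+ r)) ℕ.+ t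
    arith = solve-∀

  memory-run : ∀ {a b k M} (t : Tree a b) (s : Strategy b (suc k)) →
               k ℕ.+ register t ℕ.≤ M → memory s ℕ.≤ M → memory (run t s) ℕ.≤ M
  memory-run {k = k} leaf s k+1≤M s≤M =
    ℕ.⊔-lub (ℕ.m+n≤o⇒m≤o k k+1≤M)
      (ℕ.⊔-lub (ℕ.≤-trans (ℕ.≤-reflexive (ℕ.+-comm 1 k)) k+1≤M) s≤M)
  memory-run {k = k} {M} (join w l r) s k+lr≤M s≤M =
    memory-run l _ k+l≤M (memory-run r _ k+r≤M (memory-compare (rounds w) 0 0 s 2+k≤M s≤M))
    where
    k+l≤M : k ℕ.+ register l ℕ.≤ M
    k+l≤M = ℕ.≤-trans (ℕ.+-monoʳ-≤ k (ℕ.m≤m⊔n _ _)) k+lr≤M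
    k+r≤M : suc k ℕ.+ register r ℕ.≤ M
    k+r≤M = ℕ.≤-trans (ℕ.≤-reflexive (≡.sym (ℕ.+-suc k (register r))))
      (ℕ.≤-trans (ℕ.+-monoʳ-≤ k (ℕ.m≤n⊔m _ _)) k+lr≤M)
    0<register : ∀ {a b} (t : Tree a b) → 0 ℕ.< register t
    0<register leaf         = ℕ.s≤s ℕ.z≤n
    0<register (join _ l r) = ℕ.m≤n⇒m≤o⊔n (register l) (ℕ.s≤s ℕ.z≤n)
    2+k≤M : suc (suc k) ℕ.≤ M
    2+k≤M = ℕ.≤-trans (ℕ.≤-reflexive (ℕ.+-comm 1 (suc k)))
      (ℕ.≤-trans (ℕ.+-monoʳ-≤ (suc k) (0<register r)) k+r≤M)

skip : ∀ {a b k} → b ≤′ a → Strategy b k → Strategy a k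
skip (≤′-reflexive ≡.refl) s = s
skip (≤′-step b≤a)         s = next (skip b≤a s)

tosses-skip : ∀ {a b k} (b≤a : b ≤′ a) (s : Strategy b k) → tosses (skip b≤a s) ≡ tosses s
tosses-skip (≤′-reflexive ≡.refl) s = ≡.refl
tosses-skip (≤′-step b≤a)         s = tosses-skip b≤a s

memory-skip : ∀ {a b k M} (b≤a : b ≤′ a) (s : Strategy b k) → k ℕ.≤ M →
              memory s ℕ.≤ M → memory (skip b≤a s) ℕ.≤ M
memory-skip (≤′-reflexive ≡.refl) s k≤M s≤M = s≤M
memory-skip (≤′-step b≤a)         s k≤M s≤M = ℕ.⊔-lub k≤M (memory-skip b≤a s k≤M s≤M)

-- Positions in the stream

dropTo : ∀ {a} {A : Set a} {u v} → v ≤′ u → Vec A u → Vec A v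
dropTo (≤′-reflexive ≡.refl) xs       = xs
dropTo (≤′-step v≤u)         (_ ∷ xs) = dropTo v≤u xs

-- At z j xs: z occurs in xs, followed by exactly j further entries.
data At {a} {A : Set a} (z : A) (j : ℕ) : ∀ {n} → Vec A n → Set a where
  here  : {xs : Vec A j} → At z j (z ∷ xs)
  there : ∀ {n x} {xs : Vec A n} → At z j xs → At z j (x ∷ xs)

At⇒< : ∀ {a} {A : Set a} {z : A} {j n} {xs : Vec A n} → At z j xs → j ℕ.< n
At⇒< here       = ℕ.≤-refl
At⇒< (there at) = ℕ.m≤n⇒m≤1+n (At⇒< at)

At-tail : ∀ {a} {A : Set a} {z : A} {j n x} {xs : Vec A n} →
          j ℕ.< n → At z j (x ∷ xs) → At z j xs
At-tail j<n here       = ⊥-elim (ℕ.<-irrefl ≡.refl j<n)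
At-tail j<n (there at) = at

tree-≤ : ∀ {a b} → Tree a b → b ℕ.≤ a
tree-≤ leaf         = ℕ.n≤1+n _
tree-≤ (join _ l r) = ℕ.≤-trans (tree-≤ r) (tree-≤ l)

-- Positions are counted from the end, so `j` stays the same while a prefix is consumed; `j < v`
-- says that `z` lies beyond that prefix.
At-rest : ∀ {a} {A : Set a} {z : A} {j u v} (t : Tree u v) {xs : Vec A u} →
          j ℕ.< v → At z j xs → At z j (rest t xs)
At-rest leaf         {_ ∷ _} j<v at = At-tail j<v at
At-rest (join _ l r) j<v at =
  At-rest r j<v (At-rest l (ℕ.<-≤-trans j<v (tree-≤ r)) at)

At-dropTo : ∀ {a} {A : Set a} {z : A} {j u v} (v≤u : v ≤′ u) {xs : Vec A u} →
            j ℕ.< v → At z j xs → At z j (dropTo v≤u xs)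
At-dropTo (≤′-reflexive ≡.refl) j<v at = at
At-dropTo (≤′-step v≤u) {_ ∷ _} j<v at =
  At-dropTo v≤u j<v (At-tail (ℕ.<-≤-trans j<v (ℕ.≤′⇒≤ v≤u)) at)

At-lookup : ∀ {a} {A : Set a} {n} (xs : Vec A n) i → ∃[ j ] At (lookup xs i) j xs
At-lookup (x ∷ xs) zero    = _ , here
At-lookup (x ∷ xs) (suc i) with At-lookup xs i
... | j , at = j , there at

At-permutation : ∀ {n} (σ : Permutation′ n) i → ∃[ j ] At i j (tabulate (σ ⟨$⟩ʳ_))
At-permutation σ i with At-lookup (tabulate (σ ⟨$⟩ʳ_)) (σ ⟨$⟩ˡ i)
... | j , at = j , ≡.subst (λ x → At x j (tabulate (σ ⟨$⟩ʳ_)))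
  (≡.trans (lookup∘tabulate (σ ⟨$⟩ʳ_) (σ ⟨$⟩ˡ i)) (inverseʳ σ)) at

-- Success probabilities of comparisons and tournaments

module Correctness {c ℓ₁ ℓ₂} (ℝ : Reals c ℓ₁ ℓ₂) where
  open Reals ℝ hiding (zero)
  open OrderedField ℝ
  open Coins ℝ
  open ≤-Reasoning

  -- Chernoff's argument: as down * up ≥ 1, the potential is at least 1 when the
  -- comparison goes wrong, while each round multiplies its expectation by a
  -- factor at most 1 - b².
  module Comparison
    (p q b : Carrier) (0≤p : 0# ≤ p) (p≤1 : p ≤ 1#) (0≤q : 0# ≤ q) (q≤1 : q ≤ 1#)
    (0≤b : 0# ≤ b) (b≤1 : b ≤ 1#) (gap : q + (b + b) ≤ p)
    (V : Carrier) (V≤1 : V ≤ 1#) (G : ℕ → ℕ → ℕ → Carrier)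
    (base : ∀ x y → (x ℕ.≤ y × 0# ≤ G 0 x y) ⊎ V ≤ G 0 x y)
    (step : ∀ r x y → G (suc r) x y ≈
      p * (q * G r (suc x) (suc y) + (1# - q) * G r (suc x) y)
        + (1# - p) * (q * G r x (suc y) + (1# - q) * G r x y))
    where

    -- A head of the better coin multiplies the potential by `down`, a head of the other coin by
    -- `up`. `down` is a polynomial substitute for 1/(1 + b): the product is 1 + b³, at least 1
    -- without any division.
    up down : Carrier
    up   = 1# + b
    down = 1# - b + b * b

    0≤up : 0# ≤ up
    0≤up = +-nonneg 0≤1 0≤b

    0≤down : 0# ≤ down
    0≤down = +-nonneg (x≤y⇒0≤y-x b≤1) (*-nonneg 0≤b 0≤b)

    1≤down*up : 1# ≤ down * up
    1≤down*up = ≤-by (*-nonneg 0≤b (*-nonneg 0≤b 0≤b))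
      (solve 1 (λ b → :1 :+ b :* (b :* b) := (:1 :- b :+ b :* b) :* (:1 :+ b)) refl b)

    potential : ℕ → ℕ → Carrier
    potential x y = down ^ x * up ^ y

    0≤potential : ∀ x y → 0# ≤ potential x y
    0≤potential x y = *-nonneg (^-nonneg x 0≤down) (^-nonneg y 0≤up)

    1≤potential : ∀ {x y} → x ℕ.≤ y → 1# ≤ potential x y
    1≤potential {x} {y} x≤y = begin
      1#                                   ≈⟨ *-identityˡ 1# ⟨
      1# * 1#                              ≤⟨ *-mono-≤ 0≤1 (^-nonneg d 0≤up) (1≤^ x 1≤down*up) (1≤^ d (x≤x+y 1# 0≤b)) ⟩
      (down * up) ^ x * up ^ d             ≈⟨ *-congʳ (*-^-distrib down up x) ⟩
      down ^ x * up ^ x * up ^ d           ≈⟨ *-assoc _ _ _ ⟩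
      down ^ x * (up ^ x * up ^ d)         ≈⟨ *-congˡ (^-homo-* up x d) ⟨
      down ^ x * up ^ (x ℕ.+ d)            ≡⟨ ≡.cong (λ z → down ^ x * up ^ z) (ℕ.m+[n∸m]≡n x≤y) ⟩
      down ^ x * up ^ y                    ∎
      where d = y ℕ.∸ x

    factor : Carrier
    factor = (p * down + (1# - p)) * (q * up + (1# - q))

    -- To first order the factor loses (p - q)b, at least 2b² by the gap. The remaining terms, p ·
    -- b² · (1 - q(1 - b)), give back at most b².
    factor≤1-b² : factor ≤ 1# - b * b
    factor≤1-b² = ≤-by
      (+-nonneg (*-nonneg (x≤y⇒0≤y-x gap) 0≤b)
        (*-nonneg (*-nonneg 0≤b 0≤b)
          (+-nonneg (x≤y⇒0≤y-x p≤1) (*-nonneg (*-nonneg 0≤p 0≤q) (x≤y⇒0≤y-x b≤1)))))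
      (solve 3 (λ p q b →
        (p :* (:1 :- b :+ b :* b) :+ (:1 :- p)) :* (q :* (:1 :+ b) :+ (:1 :- q))
          :+ ((p :- (q :+ (b :+ b))) :* b
               :+ b :* b :* ((:1 :- p) :+ p :* q :* (:1 :- b)))
        := :1 :- b :* b) refl p q b)

    0≤1-b² : 0# ≤ 1# - b * b
    0≤1-b² = x≤y⇒0≤y-x (≤-trans (*-mono-≤ 0≤b 0≤1 b≤1 b≤1) (≤-reflexive (*-identityˡ 1#)))

    -- Averaging the bound for r rounds over the four outcomes of a round multiplies the potential
    -- by `factor`, so the tallies must be arbitrary in the induction. After the last round a wrong
    -- verdict has potential at least 1 ≥ V, which makes the left side at most 0.
    G-≥ : ∀ r x y → V - potential x y * (1# - b * b) ^ r ≤ G r x y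
    G-≥ zero x y with base x y
    ... | inj₁ (x≤y , 0≤G) = begin
      V - potential x y * 1#   ≈⟨ +-congˡ (-‿cong (*-identityʳ _)) ⟩
      V - potential x y        ≤⟨ x-y≤0 (≤-trans V≤1 (1≤potential x≤y)) ⟩
      0#                       ≤⟨ 0≤G ⟩
      G 0 x y                  ∎
      where
      x-y≤0 : ∀ {x y} → x ≤ y → x - y ≤ 0#
      x-y≤0 {x} {y} x≤y = ≤-trans (+-monoˡ-≤ (- y) x≤y) (≤-reflexive (-‿inverseʳ y))
    ... | inj₂ V≤G = ≤-trans (x-y≤x V (*-nonneg (0≤potential x y) 0≤1)) V≤G
    G-≥ (suc r) x y = begin
      V - potential x y * (k * k ^ r)
        ≤⟨ +-monoʳ-≤ V (neg-mono (*-monoʳ-≤ _ (0≤potential x y)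
             (*-monoˡ-≤ _ (^-nonneg r 0≤1-b²) factor≤1-b²))) ⟩
      V - potential x y * (factor * k ^ r)
        ≈⟨ solve 8 (λ p q V u d m n z →
             V :- m :* n :* ((p :* d :+ (:1 :- p)) :* (q :* u :+ (:1 :- q)) :* z)
             := p :* (q :* (V :- d :* m :* (u :* n) :* z) :+ (:1 :- q) :* (V :- d :* m :* n :* z))
                :+ (:1 :- p) :* (q :* (V :- m :* (u :* n) :* z) :+ (:1 :- q) :* (V :- m :* n :* z)))
           refl p q V up down (down ^ x) (up ^ y) (k ^ r) ⟩
      p * (q * (V - potential (suc x) (suc y) * k ^ r) + (1# - q) * (V - potential (suc x) y * k ^ r))
        + (1# - p) * (q * (V - potential x (suc y) * k ^ r) + (1# - q) * (V - potential x y * k ^ r))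
        ≤⟨ convex-mono-≤ 0≤p p≤1
             (convex-mono-≤ 0≤q q≤1 (G-≥ r (suc x) (suc y)) (G-≥ r (suc x) y))
             (convex-mono-≤ 0≤q q≤1 (G-≥ r x (suc y)) (G-≥ r x y)) ⟩
      p * (q * G r (suc x) (suc y) + (1# - q) * G r (suc x) y)
        + (1# - p) * (q * G r x (suc y) + (1# - q) * G r x y)
        ≈⟨ step r x y ⟨
      G (suc r) x y ∎
      where
      k = 1# - b * b
      neg-mono : ∀ {x y} → x ≤ y → - y ≤ - x
      neg-mono {x} {y} x≤y = 0≤y-x⇒x≤y (≤-trans (x≤y⇒0≤y-x x≤y)
        (≤-reflexive (solve 2 (λ x y → y :- x := :- x :- :- y) refl x y)))

    G-≥′ : ∀ r → V - (1# - b * b) ^ r ≤ G r 0 0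
    G-≥′ r = ≤-trans
      (≤-reflexive (solve 2 (λ V z → V :- z := V :- :1 :* :1 :* z) refl V ((1# - b * b) ^ r)))
      (G-≥ r 0 0)

  error : ∀ (D w : ℕ) → Carrier
  error D w = ½ ^ (D ℕ.+ w)

  0≤error : ∀ D w → 0# ≤ error D w
  0≤error D w = 0≤½^ (D ℕ.+ w)

  -- The errors along every path from the root to a leaf sum to at most `e`. Paths suffice because
  -- the best coin takes part only in the joins above its leaf.
  Safe : ∀ {a b} → ℕ → Tree a b → Carrier → Set ℓ₂
  Safe D leaf         e = 0# ≤ e
  Safe D (join w l r) e = Safe D l (e - error D w) × Safe D r (e - error D w)

  Safe-mono : ∀ {a b} D (t : Tree a b) {e e′} → e ≤ e′ → Safe D t e → Safe D t e′
  Safe-mono D leaf         e≤e′ 0≤e     = ≤-trans 0≤e e≤e′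
  Safe-mono D (join w l r) e≤e′ (sl , sr) =
    Safe-mono D l (+-monoˡ-≤ _ e≤e′) sl , Safe-mono D r (+-monoˡ-≤ _ e≤e′) sr

  -- Each group of `R` factors is at most 1/(1 + Rγ) ≤ 1/2: `R` rounds buy one bit of confidence.
  ^-≤½^ : ∀ {γ} R k → 0# ≤ γ → γ ≤ 1# → 1# ≤ fromℕ R * γ → (1# - γ) ^ (R ℕ.* k) ≤ ½ ^ k
  ^-≤½^ {γ} R k 0≤γ γ≤1 1≤Rγ = begin
    (1# - γ) ^ (R ℕ.* k)    ≈⟨ ^-assocʳ (1# - γ) R k ⟨
    z ^ k                   ≤⟨ ^-monoˡ-≤ k 0≤z z≤½ ⟩
    ½ ^ k                   ∎
    where
    z = (1# - γ) ^ R
    0≤z : 0# ≤ z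
    0≤z = ^-nonneg R (x≤y⇒0≤y-x γ≤1)
    z≤½ : z ≤ ½
    z≤½ = *-cancelˡ-≤ (fromℕ 2) (fromℕ-pos 1) (begin
      fromℕ 2 * z               ≈⟨ *-comm _ _ ⟩
      z * fromℕ 2               ≈⟨ *-congˡ (+-congˡ fromℕ-1) ⟩
      z * (1# + 1#)             ≤⟨ *-monoʳ-≤ z 0≤z (+-monoʳ-≤ 1# 1≤Rγ) ⟩
      z * (1# + fromℕ R * γ)    ≤⟨ bernoulli-recip R 0≤γ γ≤1 ⟩
      1#                        ≈⟨ recip-inverseʳ (fromℕ 2) (fromℕ-pos 1) ⟨
      fromℕ 2 * ½               ∎)

  module Search {n} (p : Fin n → Carrier) (bias : ∀ i → IsBias (p i)) (best : Fin n)
    (Δ : Carrier) (0≤Δ : 0# ≤ Δ) (Δ≤1 : Δ ≤ 1#) (gap : ∀ i → i ≢ best → p i + Δ ≤ p best)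
    (R : ℕ) (4≤RΔ² : fromℕ 4 ≤ fromℕ R * (Δ * Δ)) (D : ℕ)
    where

    private
      P : ∀ {u k} → Strategy u k → Vec (Fin n) u → Vec (Fin n) k → Carrier
      P = outputProbability p best

      0≤p : ∀ i → 0# ≤ p i
      0≤p i = proj₁ (bias i)
      p≤1 : ∀ i → p i ≤ 1#
      p≤1 i = proj₂ (bias i)

      -- Half the gap, since `Comparison` asks for a separation of 2b. The rate b² is then Δ²/4,
      -- whence the 4 in `4≤RΔ²`.
      b : Carrier
      b = ½ * Δ
      0≤b : 0# ≤ b
      0≤b = *-nonneg (<⇒≤ 0<½) 0≤Δ
      b+b≈Δ : b + b ≈ Δ
      b+b≈Δ = begin-equality
        b + b               ≈⟨ solve 2 (λ h d → h :* d :+ h :* d := (:1 :+ (:1 :+ :0)) :* h :* d) refl ½ Δ ⟩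
        fromℕ 2 * ½ * Δ     ≈⟨ *-congʳ (recip-inverseʳ (fromℕ 2) (fromℕ-pos 1)) ⟩
        1# * Δ              ≈⟨ *-identityˡ Δ ⟩
        Δ                   ∎
      b≤1 : b ≤ 1#
      b≤1 = ≤-trans (≤-by 0≤b b+b≈Δ) Δ≤1
      b²≤1 : b * b ≤ 1#
      b²≤1 = ≤-trans (*-mono-≤ 0≤b 0≤1 b≤1 b≤1) (≤-reflexive (*-identityˡ 1#))
      1≤Rb² : 1# ≤ fromℕ R * (b * b)
      1≤Rb² = begin
        1#                                  ≈⟨ 2^n*½^n≈1 2 ⟨
        fromℕ 4 * ½ ^ 2                     ≤⟨ *-monoˡ-≤ _ (0≤½^ 2) 4≤RΔ² ⟩
        fromℕ R * (Δ * Δ) * ½ ^ 2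
          ≈⟨ solve 3 (λ r h d → r :* (d :* d) :* (h :* (h :* :1)) := r :* (h :* d :* (h :* d))) refl _ ½ Δ ⟩
        fromℕ R * (b * b)                   ∎

    rounds : ℕ → ℕ
    rounds w = R ℕ.* (D ℕ.+ w)

    0≤P : ∀ {u k} (s : Strategy u k) xs m → 0# ≤ P s xs m
    0≤P (tossCurrent s) (x ∷ xs) m =
      convex-≤ (0≤p x) (p≤1 x) (0≤P (s true) (x ∷ xs) m) (0≤P (s false) (x ∷ xs) m)
    0≤P (tossStored i s) xs m =
      convex-≤ (0≤p _) (p≤1 _) (0≤P (s true) xs m) (0≤P (s false) xs m)
    0≤P (store s) (x ∷ xs) m = 0≤P s (x ∷ xs) (x ∷ m)
    0≤P (discard i s) xs m = 0≤P s xs (removeAt m i)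
    0≤P (randomise B s) xs m =
      *-nonneg (<⇒≤ (recip-pos _ (fromℕ-pos B))) (sum-nonneg _ (λ i → 0≤P (s i) xs m))
    0≤P (next s) (x ∷ xs) m = 0≤P s xs m
    0≤P (output i) [] m with lookup m i ≟ best
    ... | yes _ = 0≤1
    ... | no _  = ≤-refl

    module _ {u k} (s : Strategy u (suc k)) (xs : Vec (Fin n) u) (m : Vec (Fin n) k) where

      compare-≥ : ∀ {V i j} r x y → V ≤ P s xs (i ∷ m) → V ≤ P s xs (j ∷ m) →
                  V ≤ P (compare r x y s) xs (i ∷ j ∷ m)
      compare-≥ {V} {i} {j} zero x y V≤i V≤j = keepLarger-≥ (ℕ.≤-<-connex x y)
        where
        keepLarger-≥ : ∀ v → V ≤ P (keepLarger v s) xs (i ∷ j ∷ m)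
        keepLarger-≥ (inj₁ _) = V≤j
        keepLarger-≥ (inj₂ _) = V≤i
      compare-≥ {V} {i} {j} (suc r) x y V≤i V≤j = convex-≤ (0≤p i) (p≤1 i)
        (convex-≤ (0≤p j) (p≤1 j) (IH true true) (IH true false))
        (convex-≤ (0≤p j) (p≤1 j) (IH false true) (IH false false))
        where
        IH : ∀ h h′ → V ≤ P (compare r (tally h x) (tally h′ y) s) xs (i ∷ j ∷ m)
        IH h h′ = compare-≥ r (tally h x) (tally h′ y) V≤i V≤j

      module _ {V : Carrier} (V≤1 : V ≤ 1#) (V≤best : V ≤ P s xs (best ∷ m)) where

        private
          gap-b : ∀ i → i ≢ best → p i + (b + b) ≤ p best
          gap-b i i≢best = ≤-trans (+-monoʳ-≤ _ (≤-reflexive b+b≈Δ)) (gap i i≢best)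

          error-≥ : ∀ w → V - error D w ≤ V - (1# - b * b) ^ rounds w
          error-≥ w = ≤-by (x≤y⇒0≤y-x (^-≤½^ R (D ℕ.+ w) (*-nonneg 0≤b 0≤b) b²≤1 1≤Rb²))
            (solve 3 (λ V e z → V :- e :+ (e :- z) := V :- z) refl V _ _)

        -- The best coin is the right champion, and a tie counts as an error. Nothing records that
        -- the opponent is a different coin; if `i` is the best coin, either verdict is good.
        compare-best₀ : ∀ w i → V - error D w ≤ P (compare (rounds w) 0 0 s) xs (best ∷ i ∷ m)
        compare-best₀ w i with i ≟ best
        ... | yes ≡.refl = ≤-trans (x-y≤x V (0≤error D w)) (compare-≥ (rounds w) 0 0 V≤best V≤best)
        ... | no i≢best = ≤-trans (error-≥ w) (G-≥′ (rounds w))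
          where
          base : ∀ x y (v : x ℕ.≤ y ⊎ y ℕ.< x) →
                 (x ℕ.≤ y × 0# ≤ P (keepLarger v s) xs (best ∷ i ∷ m)) ⊎
                 V ≤ P (keepLarger v s) xs (best ∷ i ∷ m)
          base x y (inj₁ x≤y) = inj₁ (x≤y , 0≤P s xs (i ∷ m))
          base x y (inj₂ _)   = inj₂ V≤best
          open Comparison (p best) (p i) b (0≤p best) (p≤1 best) (0≤p i) (p≤1 i) 0≤b b≤1
            (gap-b i i≢best) V V≤1 (λ r x y → P (compare r x y s) xs (best ∷ i ∷ m))
            (λ x y → base x y (ℕ.≤-<-connex x y)) (λ r x y → refl)

        -- The same Chernoff bound with the tallies exchanged and the two tosses of a round
        -- interchanged. Here a tie favours the best coin.
        compare-best₁ : ∀ w i → V - error D w ≤ P (compare (rounds w) 0 0 s) xs (i ∷ best ∷ m)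
        compare-best₁ w i with i ≟ best
        ... | yes ≡.refl = ≤-trans (x-y≤x V (0≤error D w)) (compare-≥ (rounds w) 0 0 V≤best V≤best)
        ... | no i≢best = ≤-trans (error-≥ w) (G-≥′ (rounds w))
          where
          base : ∀ x y (v : y ℕ.≤ x ⊎ x ℕ.< y) →
                 (x ℕ.≤ y × 0# ≤ P (keepLarger v s) xs (i ∷ best ∷ m)) ⊎
                 V ≤ P (keepLarger v s) xs (i ∷ best ∷ m)
          base x y (inj₁ _)   = inj₂ V≤best
          base x y (inj₂ x<y) = inj₁ (ℕ.<⇒≤ x<y , 0≤P s xs (i ∷ m))
          open Comparison (p best) (p i) b (0≤p best) (p≤1 best) (0≤p i) (p≤1 i) 0≤b b≤1
            (gap-b i i≢best) V V≤1 (λ r x y → P (compare r y x s) xs (i ∷ best ∷ m))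
            (λ x y → base x y (ℕ.≤-<-connex y x))
            (λ r x y → solve 6 (λ p q a b c d →
               q :* (p :* a :+ (:1 :- p) :* b) :+ (:1 :- q) :* (p :* c :+ (:1 :- p) :* d)
               := p :* (q :* a :+ (:1 :- q) :* c) :+ (:1 :- p) :* (q :* b :+ (:1 :- q) :* d))
               refl (p best) (p i) _ _ _ _)

    -- Serves the subtrees without the best coin: their champion is unknown, so the continuation has
    -- to be good for each possible one.
    run-≥ : ∀ {u v k V} (t : Tree u v) (s : Strategy v (suc k)) xs m →
            (∀ i → V ≤ P s (rest t xs) (i ∷ m)) → V ≤ P (run rounds t s) xs m
    run-≥ leaf         s (x ∷ xs) m V≤ = V≤ x
    run-≥ (join w l r) s xs m V≤ =
      run-≥ l _ xs m λ i → run-≥ r _ (rest l xs) (i ∷ m) λ j →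
        compare-≥ s _ m (rounds w) 0 0 (V≤ j) (V≤ i)

    -- Comparing `j` with the split point of a join tells which side holds the best coin. That side
    -- is handled by induction, the other by `run-≥`, and the join spends its own error out of `e`.
    run-finds-best : ∀ {u v k V e j} (t : Tree u v) (s : Strategy v (suc k)) xs m →
                     V ≤ 1# → Safe D t e → At best j xs → v ℕ.≤ j →
                     V ≤ P s (rest t xs) (best ∷ m) → V - e ≤ P (run rounds t s) xs m
    run-finds-best leaf s (x ∷ xs) m V≤1 0≤e here v≤j V≤ = ≤-trans (x-y≤x _ 0≤e) V≤
    run-finds-best leaf s (x ∷ xs) m V≤1 0≤e (there at) v≤j V≤ =
      ⊥-elim (ℕ.<⇒≱ (At⇒< at) v≤j)
    run-finds-best {V = V} {e} {j} (join {b = b} w l r) s xs m V≤1 (safe-l , safe-r) at v≤j V≤ =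
      ≤-trans (≤-reflexive (solve 3 (λ V e z → V :- e := V :- z :- (e :- z)) refl V e _))
        (search (ℕ.≤-<-connex b j))
      where
      V-error≤1 : V - error D w ≤ 1#
      V-error≤1 = ≤-trans (x-y≤x V (0≤error D w)) V≤1
      search : b ℕ.≤ j ⊎ j ℕ.< b →
               V - error D w - (e - error D w) ≤ P (run rounds (join w l r) s) xs m
      search (inj₁ b≤j) = run-finds-best l _ xs m V-error≤1 safe-l at b≤j
        (run-≥ r _ (rest l xs) (best ∷ m) (compare-best₁ s _ m V≤1 V≤ w))
      search (inj₂ j<b) = run-≥ l _ xs m λ i →
        run-finds-best r _ (rest l xs) (i ∷ m) V-error≤1 safe-r (At-rest l j<b at) v≤j
          (compare-best₀ s _ m V≤1 V≤ w i)

    P-skip : ∀ {u v k} (v≤u : v ≤′ u) (s : Strategy v k) xs m →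
             P (skip v≤u s) xs m ≡ P s (dropTo v≤u xs) m
    P-skip (≤′-reflexive ≡.refl) s xs       m = ≡.refl
    P-skip (≤′-step v≤u)         s (x ∷ xs) m = P-skip v≤u s xs m

-- Sizes, labels and weights of the levels

n<2^n : ∀ n → n ℕ.< 2 ℕ.^ n
n<2^n zero    = ℕ.s≤s ℕ.z≤n
n<2^n (suc n) = begin-strict
  1 ℕ.+ n              <⟨ ℕ.+-mono-≤-< (ℕ.m^n>0 2 n) (n<2^n n) ⟩
  2 ℕ.^ n ℕ.+ 2 ℕ.^ n  ≡⟨ ≡.cong (2 ℕ.^ n ℕ.+_) (≡.sym (ℕ.+-identityʳ _)) ⟩
  2 ℕ.^ suc n          ∎
  where open ℕ.≤-Reasoning

n<tower : ∀ n → n ℕ.< tower n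
n<tower zero    = ℕ.s≤s ℕ.z≤n
n<tower (suc n) = ℕ.≤-<-trans (n<tower n) (n<2^n (tower n))

capacity : ℕ → ℕ
capacity ℓ = tower ℓ ℕ.* 2 ℕ.^ ℓ

tower≤capacity : ∀ ℓ → tower ℓ ℕ.≤ capacity ℓ
tower≤capacity ℓ = ℕ.m≤m*n (tower ℓ) (2 ℕ.^ ℓ) {{ℕ.m^n≢0 2 ℓ}}

-- The logarithm of capacity (suc ℓ), which bounds the number of joins on a path
-- at level suc ℓ, plus suc ℓ, to make the error probabilities summable over ℓ.
label : ℕ → ℕ
label ℓ = (tower ℓ ℕ.+ suc ℓ) ℕ.+ suc ℓ

-- Strict because a join labelled w weighs w + 1.
label<4*tower : ∀ ℓ → label ℓ ℕ.< 4 ℕ.* tower ℓ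
label<4*tower ℓ = begin-strict
  t ℕ.+ suc ℓ ℕ.+ suc ℓ    ≤⟨ ℕ.+-mono-≤ (ℕ.+-monoʳ-≤ t (n<tower ℓ)) (n<tower ℓ) ⟩
  t ℕ.+ t ℕ.+ t            <⟨ ℕ.m<m+n _ (ℕ.≤-<-trans ℕ.z≤n (n<tower ℓ)) ⟩
  t ℕ.+ t ℕ.+ t ℕ.+ t      ≡⟨ arith t ⟩
  4 ℕ.* t                  ∎
  where
  open ℕ.≤-Reasoning
  t = tower ℓ
  arith : ∀ t → t ℕ.+ t ℕ.+ t ℕ.+ t ≡ 4 ℕ.* t
  arith = solve-∀

-- T * P is the size of a block, so c * (T * P) ≤ s makes the c joins cost O(s / P).
level-weight : ∀ {P T W wt s c} → W ℕ.≤ 4 ℕ.* T → c ℕ.* (T ℕ.* P) ℕ.≤ s →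
  P ℕ.* wt ℕ.+ 8 ℕ.* s ℕ.≤ 8 ℕ.* P ℕ.* s ℕ.+ c ℕ.* (P ℕ.* W) →
  2 ℕ.* P ℕ.* wt ℕ.+ 8 ℕ.* s ℕ.≤ 8 ℕ.* (2 ℕ.* P) ℕ.* s
level-weight {P} {T} {W} {wt} {s} {c} W≤4T cTP≤s h = ℕ.+-cancelʳ-≤ (8 ℕ.* s) _ _ (begin
  2 ℕ.* P ℕ.* wt ℕ.+ 8 ℕ.* s ℕ.+ 8 ℕ.* s         ≡⟨ arith₁ P wt s ⟩
  2 ℕ.* (P ℕ.* wt ℕ.+ 8 ℕ.* s)                   ≤⟨ ℕ.*-monoʳ-≤ 2 h ⟩
  2 ℕ.* (8 ℕ.* P ℕ.* s ℕ.+ c ℕ.* (P ℕ.* W))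
    ≤⟨ ℕ.*-monoʳ-≤ 2 (ℕ.+-monoʳ-≤ (8 ℕ.* P ℕ.* s) (ℕ.*-monoʳ-≤ c (ℕ.*-monoʳ-≤ P W≤4T))) ⟩
  2 ℕ.* (8 ℕ.* P ℕ.* s ℕ.+ c ℕ.* (P ℕ.* (4 ℕ.* T)))   ≡⟨ arith₂ P s c T ⟩
  8 ℕ.* (2 ℕ.* P) ℕ.* s ℕ.+ 8 ℕ.* (c ℕ.* (T ℕ.* P))
    ≤⟨ ℕ.+-monoʳ-≤ (8 ℕ.* (2 ℕ.* P) ℕ.* s) (ℕ.*-monoʳ-≤ 8 cTP≤s) ⟩
  8 ℕ.* (2 ℕ.* P) ℕ.* s ℕ.+ 8 ℕ.* s              ∎)
  where
  open ℕ.≤-Reasoning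
  arith₁ : ∀ P wt s → 2 ℕ.* P ℕ.* wt ℕ.+ 8 ℕ.* s ℕ.+ 8 ℕ.* s ≡ 2 ℕ.* (P ℕ.* wt ℕ.+ 8 ℕ.* s)
  arith₁ = solve-∀
  arith₂ : ∀ P s c T → 2 ℕ.* (8 ℕ.* P ℕ.* s ℕ.+ c ℕ.* (P ℕ.* (4 ℕ.* T))) ≡
                       8 ℕ.* (2 ℕ.* P) ℕ.* s ℕ.+ 8 ℕ.* (c ℕ.* (T ℕ.* P))
  arith₂ = solve-∀

-- Sizes are numbers of coins minus one, so a join adds one unit to their sum. This adds 8 on the
-- left and 8P on the right, while the join's own weight goes into the extra term counted by
-- `suc c`.
join-weight : ∀ {P w wl wr sl sr c} → 1 ℕ.≤ P →
  P ℕ.* wl ℕ.+ 8 ℕ.* sl ℕ.≤ 8 ℕ.* P ℕ.* sl ℕ.+ c ℕ.* (P ℕ.* suc w) →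
  P ℕ.* wr ℕ.+ 8 ℕ.* sr ℕ.≤ 8 ℕ.* P ℕ.* sr →
  P ℕ.* (suc w ℕ.+ (wl ℕ.+ wr)) ℕ.+ 8 ℕ.* (sl ℕ.+ suc sr) ℕ.≤
    8 ℕ.* P ℕ.* (sl ℕ.+ suc sr) ℕ.+ suc c ℕ.* (P ℕ.* suc w)
join-weight {P} {w} {wl} {wr} {sl} {sr} {c} 1≤P hl hr = begin
  P ℕ.* (suc w ℕ.+ (wl ℕ.+ wr)) ℕ.+ 8 ℕ.* (sl ℕ.+ suc sr)
    ≡⟨ arith₁ P (suc w) wl wr sl sr ⟩
  (P ℕ.* wl ℕ.+ 8 ℕ.* sl) ℕ.+ (P ℕ.* wr ℕ.+ 8 ℕ.* sr) ℕ.+ 8 ℕ.* 1 ℕ.+ P ℕ.* suc w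
    ≤⟨ ℕ.+-monoˡ-≤ (P ℕ.* suc w) (ℕ.+-mono-≤ (ℕ.+-mono-≤ hl hr) (ℕ.*-monoʳ-≤ 8 1≤P)) ⟩
  (8 ℕ.* P ℕ.* sl ℕ.+ c ℕ.* (P ℕ.* suc w)) ℕ.+ 8 ℕ.* P ℕ.* sr ℕ.+ 8 ℕ.* P ℕ.+ P ℕ.* suc w
    ≡⟨ arith₂ P (suc w) sl sr c ⟩
  8 ℕ.* P ℕ.* (sl ℕ.+ suc sr) ℕ.+ suc c ℕ.* (P ℕ.* suc w) ∎
  where
  open ℕ.≤-Reasoning
  arith₁ : ∀ P w wl wr sl sr → P ℕ.* (w ℕ.+ (wl ℕ.+ wr)) ℕ.+ 8 ℕ.* (sl ℕ.+ suc sr) ≡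
    (P ℕ.* wl ℕ.+ 8 ℕ.* sl) ℕ.+ (P ℕ.* wr ℕ.+ 8 ℕ.* sr) ℕ.+ 8 ℕ.* 1 ℕ.+ P ℕ.* w
  arith₁ = solve-∀
  arith₂ : ∀ P w sl sr c →
    (8 ℕ.* P ℕ.* sl ℕ.+ c ℕ.* (P ℕ.* w)) ℕ.+ 8 ℕ.* P ℕ.* sr ℕ.+ 8 ℕ.* P ℕ.+ P ℕ.* w ≡
    8 ℕ.* P ℕ.* (sl ℕ.+ suc sr) ℕ.+ suc c ℕ.* (P ℕ.* w)
  arith₂ = solve-∀

-- Construction of the trees level by level

module Construction {c ℓ₁ ℓ₂} (ℝ : Reals c ℓ₁ ℓ₂) (D : ℕ) where
  open Reals ℝ hiding (zero)
  open OrderedField ℝ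
  open Correctness ℝ
  open ≤-Reasoning

  -- The sum of 2^-(D + i) for 1 ≤ i ≤ ℓ, one term per level of combs.
  levelError : ℕ → Carrier
  levelError ℓ = ½ ^ D * (1# - ½ ^ ℓ)

  -- Meant for s + 1 coins, so that `s` is the number of joins. 8(1 - 2^-ℓ) is the sum of 4 · 2^-i
  -- for i < ℓ, the costs of the combs made of blocks of level i.
  record LevelTree (ℓ s a b : ℕ) : Set ℓ₂ where
    field
      tree      : Tree a b
      register≤ : register tree ℕ.≤ suc ℓ
      -- weight tree ≤ 8 (1 - 2^-ℓ) s, cleared of denominators
      weight≤   : 2 ℕ.^ ℓ ℕ.* weight tree ℕ.+ 8 ℕ.* s ℕ.≤ 8 ℕ.* 2 ℕ.^ ℓ ℕ.* s
      safe      : Safe D tree (levelError ℓ)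

  record Comb (ℓ c s a b : ℕ) : Set ℓ₂ where
    field
      tree      : Tree a b
      register≤ : register tree ℕ.≤ suc (suc ℓ)
      weight≤   : 2 ℕ.^ ℓ ℕ.* weight tree ℕ.+ 8 ℕ.* s ℕ.≤
                  8 ℕ.* 2 ℕ.^ ℓ ℕ.* s ℕ.+ c ℕ.* (2 ℕ.^ ℓ ℕ.* suc (label ℓ))
      safe      : Safe D tree (levelError ℓ + fromℕ c * error D (label ℓ))

  -- The possibly incomplete block of s₀ + 1 coins comes first, followed by `c` full ones. The spine
  -- runs to the left, so however many blocks there are, one register more than a block needs is
  -- enough. Blocks enter as a function, which leaves `levelTree` a structural recursion on the
  -- level.
  comb : ∀ ℓ N s₀ → s₀ ℕ.≤ N →
         (∀ s {a b} → a ≡ b ℕ.+ suc s → s ℕ.≤ N → LevelTree ℓ s a b) →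
         ∀ c {a b} → a ≡ b ℕ.+ suc (s₀ ℕ.+ c ℕ.* suc N) → Comb ℓ c (s₀ ℕ.+ c ℕ.* suc N) a b
  comb ℓ N s₀ s₀≤N block zero a≡ rewrite ℕ.+-identityʳ s₀ = record
    { tree      = tree
    ; register≤ = ℕ.m≤n⇒m≤1+n register≤
    ; weight≤   = ℕ.m≤n⇒m≤n+o 0 weight≤
    ; safe      = Safe-mono D tree (≤-reflexive
        (solve 2 (λ e z → e := e :+ :0 :* z) refl _ _)) safe
    }
    where open LevelTree (block s₀ a≡ s₀≤N)
  comb ℓ N s₀ s₀≤N block (suc c) {a} {b} a≡ = record
    { tree      = join (label ℓ) l.tree r.tree
    ; register≤ = ℕ.⊔-lub l.register≤ (ℕ.s≤s r.register≤)
    ; weight≤   = ≡.subst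
        (λ s → 2 ℕ.^ ℓ ℕ.* weight (join (label ℓ) l.tree r.tree) ℕ.+ 8 ℕ.* s ℕ.≤
               8 ℕ.* 2 ℕ.^ ℓ ℕ.* s ℕ.+ suc c ℕ.* (2 ℕ.^ ℓ ℕ.* suc (label ℓ)))
        (size s₀ (c ℕ.* suc N) N)
        (join-weight {c = c} (ℕ.m^n>0 2 ℓ) l.weight≤ r.weight≤)
    ; safe      = Safe-mono D l.tree (≤-reflexive
                    (solve 3 (λ e k z → e :+ k :* z := e :+ (:1 :+ k) :* z :- z) refl _ (fromℕ c) _)) l.safe
                , Safe-mono D r.tree (≤-by (*-nonneg (0≤fromℕ c) (0≤error D (label ℓ)))
                    (solve 3 (λ e k z → e :+ k :* z := e :+ (:1 :+ k) :* z :- z) refl _ (fromℕ c) _)) r.safe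
    }
    where
    size : ∀ s x N → (s ℕ.+ x) ℕ.+ suc N ≡ s ℕ.+ (suc N ℕ.+ x)
    size = solve-∀
    split : ∀ b s x N → b ℕ.+ suc (s ℕ.+ (suc N ℕ.+ x)) ≡ (b ℕ.+ suc N) ℕ.+ suc (s ℕ.+ x)
    split = solve-∀
    module l = Comb (comb ℓ N s₀ s₀≤N block c
      (≡.trans a≡ (split b s₀ (c ℕ.* suc N) N)))
    module r = LevelTree (block N {b ℕ.+ suc N} {b} ≡.refl ℕ.≤-refl)

  levelTree : ∀ ℓ s {a b} → a ≡ b ℕ.+ suc s → s ℕ.< capacity ℓ → LevelTree ℓ s a b
  levelTree zero zero {a} {b} a≡ _ with ≡.trans a≡ (ℕ.+-comm b 1)
  ... | ≡.refl = record
    { tree      = leaf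
    ; register≤ = ℕ.≤-refl
    ; weight≤   = ℕ.≤-refl
    ; safe      = *-nonneg (0≤½^ D) (≤-reflexive (sym (-‿inverseʳ 1#)))
    }
  levelTree zero (suc s) a≡ (ℕ.s≤s ())
  levelTree (suc ℓ) s {a} {b} a≡ s<cap = record
    { tree      = tree
    ; register≤ = register≤
    ; weight≤   = level-weight {T = tower ℓ} {c = j} (label<4*tower ℓ) jN≤s weight≤
    ; safe      = Safe-mono D tree error≤ safe
    }
    where
    N = ℕ.pred (capacity ℓ)
    instance
      capacity≢0 : NonZero (capacity ℓ)
      capacity≢0 = ℕ.>-nonZero (ℕ.≤-trans (ℕ.≤-trans (ℕ.s≤s ℕ.z≤n) (n<tower ℓ)) (tower≤capacity ℓ))
    N+1≡cap : suc N ≡ capacity ℓ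
    N+1≡cap = ℕ.suc-pred (capacity ℓ)
    s₀ = s % suc N
    j = s / suc N
    s≡ : s ≡ s₀ ℕ.+ j ℕ.* suc N
    s≡ = m≡m%n+[m/n]*n s (suc N)
    jN≤s : j ℕ.* capacity ℓ ℕ.≤ s
    jN≤s = ≡.subst (λ K → j ℕ.* K ℕ.≤ s) N+1≡cap (m/n*n≤m s (suc N))
    theComb : Comb ℓ j s a b
    theComb = ≡.subst (λ z → Comb ℓ j z a b) (≡.sym s≡)
      (comb ℓ N s₀ (ℕ.<⇒≤pred (m%n<n s (suc N)))
        (λ s′ a≡′ s′≤N → levelTree ℓ s′ a≡′
          (≡.subst (suc s′ ℕ.≤_) N+1≡cap (ℕ.s≤s s′≤N)))
        j (≡.trans a≡ (≡.cong (λ z → b ℕ.+ suc z) s≡)))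
    open Comb theComb
    -- 2^A is exactly `capacity (suc ℓ)`, and `label ℓ` is A + suc ℓ: the at most 2^A joins together
    -- err with at most 2^-(D + suc ℓ), the increment of `levelError`.
    A = tower ℓ ℕ.+ suc ℓ
    j≤2^A : j ℕ.≤ 2 ℕ.^ A
    j≤2^A = ℕ.≤-trans (ℕ.m≤m*n j (capacity ℓ)) (ℕ.≤-trans jN≤s (ℕ.≤-trans (ℕ.<⇒≤ s<cap)
      (ℕ.≤-reflexive (≡.sym (ℕ.^-distribˡ-+-* 2 (tower ℓ) (suc ℓ))))))
    error≤ : levelError ℓ + fromℕ j * error D (label ℓ) ≤ levelError (suc ℓ)
    error≤ = begin
      levelError ℓ + fromℕ j * error D (label ℓ)
        ≤⟨ +-monoʳ-≤ _ (*-monoˡ-≤ _ (0≤error D (label ℓ)) (fromℕ-mono-≤ j≤2^A)) ⟩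
      levelError ℓ + fromℕ (2 ℕ.^ A) * error D (label ℓ)
        ≈⟨ +-congˡ (*-congˡ (trans (^-homo-* ½ D (label ℓ)) (*-congˡ (^-homo-* ½ A (suc ℓ))))) ⟩
      levelError ℓ + fromℕ (2 ℕ.^ A) * (½ ^ D * (½ ^ A * ½ ^ suc ℓ))
        ≈⟨ +-congˡ (solve 4 (λ k d a l → k :* (d :* (a :* l)) := (k :* a) :* (d :* l)) refl _ _ _ _) ⟩
      levelError ℓ + fromℕ (2 ℕ.^ A) * ½ ^ A * (½ ^ D * ½ ^ suc ℓ)
        ≈⟨ +-congˡ (*-congʳ (2^n*½^n≈1 A)) ⟩
      levelError ℓ + 1# * (½ ^ D * ½ ^ suc ℓ)
        ≈⟨ solve 3 (λ d l l′ → d :* (:1 :- l) :+ :1 :* (d :* l′) := d :* (:1 :- (l :- l′))) refl _ _ _ ⟩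
      ½ ^ D * (1# - (½ ^ ℓ - ½ ^ suc ℓ))
        ≈⟨ *-congˡ (+-congˡ (-‿cong (begin-equality
             ½ ^ ℓ - ½ ^ suc ℓ                    ≈⟨ +-congʳ (*-identityˡ _) ⟨
             1# * ½ ^ ℓ - ½ ^ suc ℓ               ≈⟨ +-congʳ (*-congʳ (recip-inverseʳ (fromℕ 2) (fromℕ-pos 1))) ⟨
             fromℕ 2 * ½ * ½ ^ ℓ - ½ ^ suc ℓ
               ≈⟨ solve 2 (λ h z → (:1 :+ (:1 :+ :0)) :* h :* z :- h :* z := h :* z) refl ½ (½ ^ ℓ) ⟩
             ½ ^ suc ℓ                            ∎))) ⟩
      levelError (suc ℓ) ∎

-- Random windows and the algorithm

-- Windows of `q` positions tile the stream from its end. The start is capped at n - q to keep the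
-- window inside the stream; a capped window reaches up to n and so still covers `j`.
window-covers : ∀ {n j q} .{{_ : NonZero q}} → q ℕ.≤ n → j ℕ.< n →
  (j / q) ℕ.* q ⊓ (n ℕ.∸ q) ℕ.≤ j × j ℕ.< (j / q) ℕ.* q ⊓ (n ℕ.∸ q) ℕ.+ q
window-covers {n} {j} {q} q≤n j<n =
  ℕ.≤-trans (ℕ.m⊓n≤m _ (n ℕ.∸ q)) (m/n*n≤m j q) , j<end (ℕ.⊓-sel ((j / q) ℕ.* q) (n ℕ.∸ q))
  where
  open ℕ.≤-Reasoning
  b = (j / q) ℕ.* q ⊓ (n ℕ.∸ q)
  j<end : b ≡ (j / q) ℕ.* q ⊎ b ≡ n ℕ.∸ q → j ℕ.< b ℕ.+ q
  j<end (inj₁ b≡) = begin-strict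
    j                              ≡⟨ m≡m%n+[m/n]*n j q ⟩
    j % q ℕ.+ (j / q) ℕ.* q        <⟨ ℕ.+-monoˡ-< _ (m%n<n j q) ⟩
    q ℕ.+ (j / q) ℕ.* q            ≡⟨ ℕ.+-comm q _ ⟩
    (j / q) ℕ.* q ℕ.+ q            ≡⟨ ≡.cong (ℕ._+ q) (≡.sym b≡) ⟩
    b ℕ.+ q                        ∎
  j<end (inj₂ b≡) = begin-strict
    j                              <⟨ j<n ⟩
    n                              ≡⟨ ≡.sym (ℕ.m∸n+n≡m q≤n) ⟩
    n ℕ.∸ q ℕ.+ q                  ≡⟨ ≡.cong (ℕ._+ q) (≡.sym b≡) ⟩
    b ℕ.+ q                        ∎

module WindowSearch {c ℓ₁ ℓ₂} (ℝ : Reals c ℓ₁ ℓ₂) (n′ k R b d : ℕ)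
  (n≤tower : suc n′ ℕ.≤ tower k) where
  open Reals ℝ hiding (zero)
  open OrderedField ℝ
  open Coins ℝ
  open Correctness ℝ
  open Construction ℝ (suc d)

  n B D s q : ℕ
  n = suc n′
  B = suc b
  D = suc d
  -- The window has ⌈n/B⌉ coins but only s ≤ (n - 1)/B joins. Charging joins instead of coins avoids
  -- a rounding loss, and no coin is tossed once B ≥ n.
  s = n′ / B
  q = suc s

  q≤n : q ℕ.≤ n
  q≤n = ℕ.s≤s (m/n≤m n′ B)

  n≤B*q : n ℕ.≤ B ℕ.* q
  n≤B*q = begin
    suc n′                       ≡⟨ ≡.cong suc (m≡m%n+[m/n]*n n′ B) ⟩
    suc (n′ % B) ℕ.+ s ℕ.* B     ≤⟨ ℕ.+-monoˡ-≤ (s ℕ.* B) (m%n<n n′ B) ⟩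
    q ℕ.* B                      ≡⟨ ℕ.*-comm q B ⟩
    B ℕ.* q                      ∎
    where open ℕ.≤-Reasoning

  offset : ℕ → ℕ
  offset r = r ℕ.* q ⊓ (n ℕ.∸ q)

  offset+q≤n : ∀ r → offset r ℕ.+ q ℕ.≤ n
  offset+q≤n r = ℕ.≤-trans (ℕ.+-monoˡ-≤ q (ℕ.m⊓n≤n (r ℕ.* q) (n ℕ.∸ q)))
    (ℕ.≤-reflexive (ℕ.m∸n+n≡m q≤n))

  windowTree : ∀ r → LevelTree k s (offset r ℕ.+ q) (offset r)
  windowTree r = levelTree k s ≡.refl
    (ℕ.≤-trans q≤n (ℕ.≤-trans n≤tower (tower≤capacity k)))

  module W (r : ℕ) = LevelTree (windowTree r)

  rounds : ℕ → ℕ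
  rounds w = R ℕ.* (D ℕ.+ w)

  finish : ∀ r → Strategy (offset r) 1
  finish r = skip ℕ.z≤′n (output zero)

  window : ℕ → Algorithm n
  window r = skip (ℕ.≤⇒≤′ (offset+q≤n r)) (run rounds (W.tree r) (finish r))

  algorithm : Algorithm n
  algorithm = randomise b λ i → window (toℕ i)

  weight≤8s : ∀ r → weight (W.tree r) ℕ.≤ 8 ℕ.* s
  weight≤8s r = ℕ.*-cancelˡ-≤ (2 ℕ.^ k) {{ℕ.m^n≢0 2 k}} (begin
    2 ℕ.^ k ℕ.* weight (W.tree r)                ≤⟨ ℕ.m≤m+n _ (8 ℕ.* s) ⟩
    2 ℕ.^ k ℕ.* weight (W.tree r) ℕ.+ 8 ℕ.* s    ≤⟨ W.weight≤ r ⟩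
    8 ℕ.* 2 ℕ.^ k ℕ.* s                          ≡⟨ arith (2 ℕ.^ k) s ⟩
    2 ℕ.^ k ℕ.* (8 ℕ.* s)                        ∎)
    where
    open ℕ.≤-Reasoning
    arith : ∀ P s → 8 ℕ.* P ℕ.* s ≡ P ℕ.* (8 ℕ.* s)
    arith = solve-∀

  rounds≤ : ∀ w → 2 ℕ.* rounds w ℕ.≤ 2 ℕ.* R ℕ.* D ℕ.* suc w
  rounds≤ w = begin
    2 ℕ.* (R ℕ.* (D ℕ.+ w))                       ≤⟨ ℕ.m≤m+n _ _ ⟩
    2 ℕ.* (R ℕ.* (D ℕ.+ w)) ℕ.+ 2 ℕ.* R ℕ.* d ℕ.* w  ≡⟨ arith R d w ⟩
    2 ℕ.* R ℕ.* D ℕ.* suc w                       ∎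
    where
    open ℕ.≤-Reasoning
    arith : ∀ R d w → 2 ℕ.* (R ℕ.* (suc d ℕ.+ w)) ℕ.+ 2 ℕ.* R ℕ.* d ℕ.* w ≡ 2 ℕ.* R ℕ.* suc d ℕ.* suc w
    arith = solve-∀

  -- 16 is two tosses per round times the weight constant 8.
  tosses-window : ∀ r → tosses (window r) ℕ.≤ 16 ℕ.* R ℕ.* D ℕ.* s
  tosses-window r = begin
    tosses (window r)                       ≡⟨ tosses-skip (ℕ.≤⇒≤′ (offset+q≤n r)) _ ⟩
    tosses (run rounds (W.tree r) (finish r)) ≤⟨ tosses-run rounds (2 ℕ.* R ℕ.* D) (W.tree r) (finish r) rounds≤ ⟩
    2 ℕ.* R ℕ.* D ℕ.* weight (W.tree r) ℕ.+ tosses (finish r)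
      ≡⟨ ≡.cong (2 ℕ.* R ℕ.* D ℕ.* weight (W.tree r) ℕ.+_)
           (tosses-skip (ℕ.z≤′n {offset r}) (output zero)) ⟩
    2 ℕ.* R ℕ.* D ℕ.* weight (W.tree r) ℕ.+ 0
      ≤⟨ ℕ.+-monoˡ-≤ 0 (ℕ.*-monoʳ-≤ (2 ℕ.* R ℕ.* D) (weight≤8s r)) ⟩
    2 ℕ.* R ℕ.* D ℕ.* (8 ℕ.* s) ℕ.+ 0       ≡⟨ arith R D s ⟩
    16 ℕ.* R ℕ.* D ℕ.* s                    ∎
    where
    open ℕ.≤-Reasoning
    arith : ∀ R D s → 2 ℕ.* R ℕ.* D ℕ.* (8 ℕ.* s) ℕ.+ 0 ≡ 16 ℕ.* R ℕ.* D ℕ.* s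
    arith = solve-∀

  B*tosses≤ : B ℕ.* tosses algorithm ℕ.≤ 16 ℕ.* (R ℕ.* (D ℕ.* n))
  B*tosses≤ = begin
    B ℕ.* tosses algorithm            ≤⟨ ℕ.*-monoʳ-≤ B (maximum-lub {B} (λ i → tosses (window (toℕ i)))
                                            (λ i → tosses-window (toℕ i))) ⟩
    B ℕ.* (16 ℕ.* R ℕ.* D ℕ.* s)      ≡⟨ arith B R D s ⟩
    16 ℕ.* (R ℕ.* (D ℕ.* (s ℕ.* B)))
      ≤⟨ ℕ.*-monoʳ-≤ 16 (ℕ.*-monoʳ-≤ R (ℕ.*-monoʳ-≤ D (ℕ.m≤n⇒m≤1+n (m/n*n≤m n′ B)))) ⟩
    16 ℕ.* (R ℕ.* (D ℕ.* n))          ∎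
    where
    open ℕ.≤-Reasoning
    arith : ∀ B R D s → B ℕ.* (16 ℕ.* R ℕ.* D ℕ.* s) ≡ 16 ℕ.* (R ℕ.* (D ℕ.* (s ℕ.* B)))
    arith = solve-∀

  memory≤ : memory algorithm ℕ.≤ k ℕ.+ 1
  memory≤ = ℕ.⊔-lub ℕ.z≤n (maximum-lub {B} (λ i → memory (window (toℕ i))) (λ i → memory-window (toℕ i)))
    where
    1≤k+1 : 1 ℕ.≤ k ℕ.+ 1
    1≤k+1 = ℕ.m≤n+m 1 k
    memory-window : ∀ r → memory (window r) ℕ.≤ k ℕ.+ 1
    memory-window r = memory-skip (ℕ.≤⇒≤′ (offset+q≤n r)) _ ℕ.z≤n
      (memory-run rounds (W.tree r) (finish r)
        (ℕ.≤-trans (W.register≤ r) (ℕ.≤-reflexive (ℕ.+-comm 1 k)))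
        (memory-skip (ℕ.z≤′n {offset r}) (output zero) 1≤k+1 1≤k+1))

  module _ (p : Fin n → Carrier) (bias : ∀ i → IsBias (p i)) (best : Fin n)
    (Δ : Carrier) (0≤Δ : 0# ≤ Δ) (Δ≤1 : Δ ≤ 1#) (gap : ∀ i → i ≢ best → p i + Δ ≤ p best)
    (4≤RΔ² : fromℕ 4 ≤ fromℕ R * (Δ * Δ)) where

    open Search p bias best Δ 0≤Δ Δ≤1 gap R 4≤RΔ² D using (0≤P; run-finds-best; P-skip)
    open ≤-Reasoning

    private
      P : ∀ {u k} → Strategy u k → Vec (Fin n) u → Vec (Fin n) k → Carrier
      P = outputProbability p best

    window-finds-best : ∀ {j xs} r → At best j xs → offset r ℕ.≤ j → j ℕ.< offset r ℕ.+ q →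
                        1# - ½ ^ D ≤ P (window r) xs []
    window-finds-best {j} {xs} r at offset≤j j<offset+q = begin
      1# - ½ ^ D                   ≤⟨ ≤-by (*-nonneg (0≤½^ D) (0≤½^ k))
        (solve 2 (λ d l → :1 :- d :+ d :* l := :1 :- d :* (:1 :- l)) refl _ _) ⟩
      1# - levelError k            ≤⟨ run-finds-best (W.tree r) (finish r) ys [] ≤-refl (W.safe r)
                                        (At-dropTo (ℕ.≤⇒≤′ (offset+q≤n r)) j<offset+q at) offset≤j
                                        1≤P-finish ⟩
      P (run rounds (W.tree r) (finish r)) ys []
                                   ≡⟨ P-skip (ℕ.≤⇒≤′ (offset+q≤n r)) _ xs [] ⟨
      P (window r) xs []           ∎
      where
      ys = dropTo (ℕ.≤⇒≤′ (offset+q≤n r)) xs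
      1≤P-output : ∀ zs → 1# ≤ P (output zero) zs (best ∷ [])
      1≤P-output [] with best ≟ best
      ... | yes _ = ≤-refl
      ... | no best≢best = ⊥-elim (best≢best ≡.refl)
      zs = rest (W.tree r) ys
      1≤P-finish : 1# ≤ P (finish r) zs (best ∷ [])
      1≤P-finish = ≡.subst (1# ≤_)
        (≡.sym (P-skip (ℕ.z≤′n {offset r}) (output zero) zs (best ∷ [])))
        (1≤P-output (dropTo (ℕ.z≤′n {offset r}) zs))

    -- One window that contains the best coin already contributes (1 - 2^-D)/B; the others are only
    -- known to contribute nonnegatively.
    success : ∀ {δ} → fromℕ B * (1# - δ) ≤ 1# - ½ ^ D → ∀ σ →
              1# - δ ≤ Pr[ algorithm outputs best ∣biases p ,order σ ]
    success {δ} enough σ with At-permutation σ best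
    ... | j , at = begin
      1# - δ                            ≈⟨ *-identityˡ _ ⟨
      1# * (1# - δ)                     ≈⟨ *-congʳ (recip-inverseˡ (fromℕ B) (fromℕ-pos b)) ⟨
      B⁻¹ * fromℕ B * (1# - δ)          ≈⟨ *-assoc _ _ _ ⟩
      B⁻¹ * (fromℕ B * (1# - δ))        ≤⟨ *-monoʳ-≤ B⁻¹ 0≤B⁻¹ (≤-trans enough hit) ⟩
      B⁻¹ * f i                         ≤⟨ *-monoʳ-≤ B⁻¹ 0≤B⁻¹ (term≤sum f (λ i → 0≤P (window (toℕ i)) xs []) i) ⟩
      B⁻¹ * sum f                       ∎
      where
      B⁻¹ = recip (fromℕ B) (fromℕ-pos b)
      0≤B⁻¹ : 0# ≤ B⁻¹
      0≤B⁻¹ = <⇒≤ (recip-pos (fromℕ B) (fromℕ-pos b))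
      xs = tabulate (σ ⟨$⟩ʳ_)
      f : Fin B → Carrier
      f i = P (window (toℕ i)) xs []
      j<n : j ℕ.< n
      j<n = At⇒< at
      j/q<B : j / q ℕ.< B
      j/q<B = m<n*o⇒m/o<n (ℕ.<-≤-trans j<n n≤B*q)
      i : Fin B
      i = fromℕ< j/q<B
      covers : offset (toℕ i) ℕ.≤ j × j ℕ.< offset (toℕ i) ℕ.+ q
      covers = ≡.subst (λ r → offset r ℕ.≤ j × j ℕ.< offset r ℕ.+ q)
        (≡.sym (toℕ-fromℕ< j/q<B)) (window-covers q≤n j<n)
      hit : 1# - ½ ^ D ≤ f i
      hit = window-finds-best (toℕ i) at (proj₁ covers) (proj₂ covers)

-- From the gap hypothesis to separation, and the final toss bound

module Gap {c ℓ₁ ℓ₂} (ℝ : Reals c ℓ₁ ℓ₂) where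
  open Reals ℝ hiding (zero)
  open OrderedField ℝ
  open Coins ℝ
  open ≤-Reasoning

  module _ {n} {p : Fin n → Carrier} {Δ : Carrier} where

    gap≤1 : IsGap p Δ → (∀ i → IsBias (p i)) → Δ ≤ 1#
    gap≤1 (i , j , _ , _ , _ , Δ≈) bias = begin
      Δ          ≈⟨ Δ≈ ⟩
      p i - p j  ≤⟨ x-y≤x (p i) (proj₁ (bias j)) ⟩
      p i        ≤⟨ proj₂ (bias i) ⟩
      1#         ∎

    -- The given `best` must be the witness `i` of the gap: otherwise its bias is at most that of
    -- the runner-up `j`, and Δ ≤ 0.
    gap-separates : 0# < Δ → IsGap p Δ → ∀ {best} → MostBiased p best →
                    ∀ x → x ≢ best → p x + Δ ≤ p best
    gap-separates 0<Δ (i , j , _ , _ , second , Δ≈) {best} mostBiased x x≢best with best ≟ i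
    ... | yes ≡.refl = begin
      p x + Δ              ≤⟨ +-mono-≤ (second x x≢best) (≤-reflexive Δ≈) ⟩
      p j + (p i - p j)    ≈⟨ x+[y-x]≈y (p j) (p i) ⟩
      p i                  ∎
    ... | no best≢i = ⊥-elim (Δ≤0 0<Δ)
      where
      Δ≤0 : Δ ≤ 0#
      Δ≤0 = begin
        Δ            ≈⟨ Δ≈ ⟩
        p i - p j    ≤⟨ +-monoˡ-≤ (- p j) (≤-trans (mostBiased i) (second best best≢i)) ⟩
        p j - p j    ≈⟨ -‿inverseʳ (p j) ⟩
        0#           ∎

module TossBound {c ℓ₁ ℓ₂} (ℝ : Reals c ℓ₁ ℓ₂) where
  open Reals ℝ hiding (zero)
  open OrderedField ℝ
  open ≤-Reasoning

  -- The number of windows multiplies the toss count in the first bound and reappears in the bound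
  -- on `D`, so it cancels.
  toss-bound : ∀ {b t R D n y L} c₁ c₂ c₃ → 0# ≤ y →
    suc b ℕ.* t ℕ.≤ c₁ ℕ.* (R ℕ.* (D ℕ.* n)) →
    fromℕ R ≤ fromℕ c₂ * y →
    fromℕ D ≤ fromℕ c₃ * (fromℕ (suc b) * L) →
    fromℕ t ≤ fromℕ (c₁ ℕ.* (c₂ ℕ.* c₃)) * (fromℕ n * y * L)
  toss-bound {b} {t} {R} {D} {n} {y} {L} c₁ c₂ c₃ 0≤y Bt≤ R≤ D≤ =
    *-cancelˡ-≤ (fromℕ (suc b)) (fromℕ-pos b) (begin
      fromℕ (suc b) * fromℕ t                      ≈⟨ fromℕ-* (suc b) t ⟨
      fromℕ (suc b ℕ.* t)                          ≤⟨ fromℕ-mono-≤ Bt≤ ⟩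
      fromℕ (c₁ ℕ.* (R ℕ.* (D ℕ.* n)))
        ≈⟨ trans (fromℕ-* c₁ _) (*-congˡ (trans (fromℕ-* R _) (*-congˡ (fromℕ-* D n)))) ⟩
      fromℕ c₁ * (fromℕ R * (fromℕ D * fromℕ n))
        ≤⟨ *-monoʳ-≤ _ (0≤fromℕ c₁) (*-mono-≤ (0≤fromℕ R)
             (*-nonneg (≤-trans (0≤fromℕ D) D≤) (0≤fromℕ n)) R≤ (*-monoˡ-≤ _ (0≤fromℕ n) D≤)) ⟩
      fromℕ c₁ * (fromℕ c₂ * y * (fromℕ c₃ * (fromℕ (suc b) * L) * fromℕ n))
        ≈⟨ solve 7 (λ c₁ c₂ c₃ b y L n →
             c₁ :* (c₂ :* y :* (c₃ :* (b :* L) :* n)) := b :* (c₁ :* (c₂ :* c₃) :* (n :* y :* L)))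
             refl (fromℕ c₁) (fromℕ c₂) (fromℕ c₃) (fromℕ (suc b)) y L (fromℕ n) ⟩
      fromℕ (suc b) * (fromℕ c₁ * (fromℕ c₂ * fromℕ c₃) * (fromℕ n * y * L))
        ≈⟨ *-congˡ (*-congʳ (trans (fromℕ-* c₁ _) (*-congˡ (fromℕ-* c₂ c₃)))) ⟨
      fromℕ (suc b) * (fromℕ (c₁ ℕ.* (c₂ ℕ.* c₃)) * (fromℕ n * y * L)) ∎)

propositionA10 :
    ∀ {c ℓ₁ ℓ₂} (ℝ : Reals c ℓ₁ ℓ₂) (log : BinaryLogarithm ℝ) →
    let open Reals ℝ
        open BinaryLogarithm log
        open Coins ℝ in
    Σ[ C ∈ ℕ ]
      (∀ (n : ℕ) .{{_ : NonZero n}} (log*n : ℕ) → IsLog* (fromℕ n) log*n →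
       ∀ (Δ δ : Carrier) (Δ>0 : 0# < Δ) (δ>0 : 0# < δ) → δ < 1# →
       Σ[ A ∈ Algorithm n ]
         ( fromℕ (tosses A)
             ≤ fromℕ C * (fromℕ n * recip (Δ * Δ) (*-pos Δ>0 Δ>0)
                            * log₂ (recip δ δ>0) (recip-pos δ δ>0))
         × memory A ℕ.≤ log*n ℕ.+ 1
         × (∀ (p : Fin n → Carrier) → (∀ i → IsBias (p i)) → IsGap p Δ →
            ∀ (best : Fin n) → MostBiased p best →
            ∀ (σ : Permutation′ n) →
            1# - δ ≤ Pr[ A outputs best ∣biases p ,order σ ])))
propositionA10 ℝ log =
  let c₂ , perBit  = Parameters.tossesPerBit ℝ log
      c₃ , windows = Parameters.windowsAndBits ℝ log
  in 16 ℕ.* (c₂ ℕ.* c₃) , λ where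
    (suc n′) log*n isLog* Δ δ Δ>0 δ>0 δ<1 →
      let open Reals ℝ using (*-pos; recip-pos)
          open OrderedField ℝ using (<⇒≤; fromℕ-cancel-≤)
          open Logarithm ℝ log using (IsLog*⇒≤tower)
          open Gap ℝ
          open TossBound ℝ
          R , R≤ , 4≤RΔ²      = perBit Δ Δ>0
          b , d , enough , D≤ = windows δ δ>0 δ<1
          open WindowSearch ℝ n′ log*n R b d (fromℕ-cancel-≤ (IsLog*⇒≤tower isLog*))
      in algorithm
       , toss-bound {b} {tosses algorithm} {R} {suc d} {suc n′} 16 c₂ c₃ (<⇒≤ (recip-pos _ (*-pos Δ>0 Δ>0))) B*tosses≤ R≤ D≤
       , memory≤
       , λ p bias isGap best mostBiased →
           success p bias best Δ (<⇒≤ Δ>0) (gap≤1 isGap bias)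
             (gap-separates Δ>0 isGap mostBiased) (4≤RΔ² (gap≤1 isGap bias)) enough
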